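{- For every $\epsilon>0$ there exists an integer $g_\epsilon<\infty$ such that $4\leq \chi^*_o(\mathcal{P}_{g_\epsilon})\leq 4+\epsilon$.
   Context: An oriented graph is a finite directed graph with no directed cycle of length 1 or 2; its girth is the length of a shortest cycle of its underlying graph. $\mathcal{P}_g$ denotes the family of oriented planar graphs of girth at least $g$. For a set $S$ of $k$ colors, a $b$-fold oriented $k$-coloring of $G$ is a map $f$ from $V(G)$ to the $b$-element subsets of $S$ such that (i) $f(x)\cap f(y)=\emptyset$ for every arc $xy$, and (ii) for all arcs $xy, zw$, $f(x)\cap f(w)\neq\emptyset$ implies $f(y)\cap f(z)=\emptyset$. $\chi^b_o(G)$ is the minimum such $k$, $\chi^*_o(G)=\lim_{b\to\infty}\chi^b_o(G)/b=\inf_{b\ge1}\chi^b_o(G)/b$, and for a family $\mathcal{F}$, $\chi^*_o(\mathcal{F})$ is the maximum (supremum) of $\chi^*_o(G)$ over $G\in\mathcal{F}$. -}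

module Defs where

open import Data.Bool.Base using (Bool; T)
open import Data.Fin.Base using (Fin; zero; suc; inject₁; fromℕ)
open import Data.Fin.Subset using (Subset; ∣_∣; _∩_; Empty; Nonempty)
open import Data.Integer.Base using (+_)
open import Data.Nat.Base as ℕ using (ℕ; NonZero)
open import Data.Product.Base using (Σ; ∃; ∃₂; _×_; _,_; proj₁)
open import Data.Rational.Base as ℚ using (ℚ; _/_)
open import Data.Rational.Properties using (<-dense; <-trans)
open import Function.Base using (_on_)
open import Function.Bundles using (_⇔_)
open import Function.Definitions using (Injective; Surjective)
open import Level using (0ℓ)
open import Relation.Binary.Core using (Rel)
open import Relation.Binary.Definitions using (Asymmetric)
open import Relation.Binary.PropositionalEquality.Core using (_≡_)
open import Relation.Binary.Construct.Closure.Equivalence using (EqClosure)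
open import Relation.Binary.Construct.Closure.ReflexiveTransitive using (Star)
open import Relation.Binary.Construct.Closure.Symmetric as Sym using (SymClosure)

-- A real number (or ±∞) given by its upper cut: Above q means that the
-- number is strictly below the rational q.

record UpperReal : Set₁ where
  field
    Above     : ℚ → Set
    upward    : ∀ {p q} → p ℚ.< q → Above p → Above q
    noMinimum : ∀ {q} → Above q → ∃ λ p → p ℚ.< q × Above p

open UpperReal public

infix 4 _≤_

_≤_ : UpperReal → UpperReal → Set
x ≤ y = ∀ {q} → Above y q → Above x q

fromℚ : ℚ → UpperReal
fromℚ p .Above q             = p ℚ.< q
fromℚ p .upward q<r p<q      = <-trans p<q q<r
fromℚ p .noMinimum p<q with <-dense p<q
... | r , p<r , r<q          = r , r<q , p<r

inf : {I : Set} → (I → UpperReal) → UpperReal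
inf x .Above q                    = ∃ λ i → Above (x i) q
inf x .upward p<q (i , a)         = i , upward (x i) p<q a
inf x .noMinimum (i , a) with noMinimum (x i) a
... | p , p<q , b                 = p , p<q , i , b

-- The supremum is below q iff some p < q is an upper bound of the family;
-- the intersection of the cuts alone could have a least element.

sup : {I : Set} → (I → UpperReal) → UpperReal
sup x .Above q                    = ∃ λ p → p ℚ.< q × (∀ i → Above (x i) p)
sup x .upward q<r (p , p<q , a)   = p , <-trans p<q q<r , a
sup x .noMinimum (p , p<q , a) with <-dense p<q
... | r , p<r , r<q               = r , r<q , p , p<r , a

module _ {I : Set} (x : I → UpperReal) where

  inf-lower : ∀ i → inf x ≤ x i
  inf-lower i a = i , a

  inf-greatest : ∀ {y} → (∀ i → y ≤ x i) → y ≤ inf x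
  inf-greatest y≤x (i , a) = y≤x i a

  sup-upper : ∀ i → x i ≤ sup x
  sup-upper i (p , p<q , a) = upward (x i) p<q (a i)

  sup-least : ∀ {y} → (∀ i → x i ≤ y) → sup x ≤ y
  sup-least {y} x≤y a with noMinimum y a
  ... | p , p<q , b = p , p<q , λ i → x≤y i b

-- Asymmetry excludes directed 2-cycles and, in the case x ≡ y, loops.

record OrientedGraph : Set where
  field
    order : ℕ
    arc   : Fin order → Fin order → Bool

  V : Set
  V = Fin order

  infix 4 _⟶_ _~_

  _⟶_ : Rel V 0ℓ
  x ⟶ y = T (arc x y)

  field
    asym : Asymmetric _⟶_

  _~_ : Rel V 0ℓ
  _~_ = SymClosure _⟶_

-- A cycle of length suc m in the underlying graph.

record Cycle (G : OrientedGraph) (m : ℕ) : Set where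
  open OrientedGraph G
  field
    length≥3  : 3 ℕ.≤ ℕ.suc m
    vertex    : Fin (ℕ.suc m) → V
    injective : Injective _≡_ _≡_ vertex
    step      : ∀ (i : Fin m) → vertex (inject₁ i) ~ vertex (suc i)
    closing   : vertex (fromℕ m) ~ vertex zero

-- Acyclic graphs have infinite girth.

Girth≥ : ℕ → OrientedGraph → Set
Girth≥ g G = ∀ {m} → Cycle G m → g ℕ.≤ ℕ.suc m

-- The equivalence relation R has exactly k classes.

Classes : {A : Set} → Rel A 0ℓ → ℕ → Set
Classes {A} R k = ∃ λ (cls : A → Fin k) →
  Surjective _≡_ _≡_ cls × (∀ x y → cls x ≡ cls y ⇔ R x y)

SameOrbit : {A : Set} → (A → A) → Rel A 0ℓ
SameOrbit h = EqClosure λ x y → h x ≡ y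

record Dart (G : OrientedGraph) : Set where
  constructor dart
  open OrientedGraph G
  field
    tail head : V
    adjacent  : tail ~ head

-- A rotation system: rot x y is the neighbour of x that follows y in the
-- cyclic order around x (its value is irrelevant unless x ~ y). As the
-- neighbours of x are finitely many, `cyclic` makes rot x a permutation of
-- them with a single cycle.

record RotationSystem (G : OrientedGraph) : Set where
  open OrientedGraph G
  open Dart
  field
    rot    : V → V → V
    closed : ∀ {x y} → x ~ y → x ~ rot x y
    cyclic : ∀ {x y z} → x ~ y → x ~ z → Star (λ u v → rot x u ≡ v) y z

  reverse : Dart G → Dart G
  reverse (dart x y x~y) = dart y x (Sym.symmetric _⟶_ x~y)

  -- The next dart along the boundary of a face.
  next : Dart G → Dart G
  next (dart x y x~y) = dart y (rot y x) (closed (Sym.symmetric _⟶_ x~y))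

  -- Every connected component of the surface on which the rotation system
  -- embeds the graph is a sphere, expressed by Euler's formula v - e + f = 2c.
  -- All four numbers count classes of darts, so isolated vertices, which do
  -- not affect planarity, contribute to none of them. No component has
  -- v - e + f > 2, so equality of the totals forces equality on each.
  record Spherical : Set where
    field
      v e f c    : ℕ
      vertices   : Classes (_≡_ on tail {G}) v
      edges      : Classes (SameOrbit reverse) e
      faces      : Classes (SameOrbit next) f
      components : Classes (EqClosure _~_ on tail {G}) c
      euler      : v ℕ.+ f ≡ e ℕ.+ 2 ℕ.* c

Planar : OrientedGraph → Set
Planar G = Σ (RotationSystem G) RotationSystem.Spherical

record FoldColoring (G : OrientedGraph) (b k : ℕ) : Set where
  open OrientedGraph G
  field
    color    : V → Subset k
    size     : ∀ x → ∣ color x ∣ ≡ b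
    disjoint : ∀ {x y} → x ⟶ y → Empty (color x ∩ color y)
    oriented : ∀ {x y z w} → x ⟶ y → z ⟶ w →
               Nonempty (color x ∩ color w) → Empty (color y ∩ color z)

-- χᵇₒ G b k: the b-fold oriented chromatic number of G is k.

χᵇₒ : OrientedGraph → ℕ → ℕ → Set
χᵇₒ G b k = FoldColoring G b k × (∀ {k′} → FoldColoring G b k′ → k ℕ.≤ k′)

record FoldNumber (G : OrientedGraph) : Set where
  field
    b k           : ℕ
    .{{nonZero}}  : NonZero b
    minimal       : χᵇₒ G b k

  ratio : ℚ
  ratio = + k / b

χ*ₒ : OrientedGraph → UpperReal
χ*ₒ G = inf λ (n : FoldNumber G) → fromℚ (FoldNumber.ratio n)

χ*ₒ-family : (OrientedGraph → Set) → UpperReal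
χ*ₒ-family F = sup λ (G : Σ OrientedGraph F) → χ*ₒ (proj₁ G)

𝒫 : ℕ → OrientedGraph → Set
𝒫 g G = Planar G × Girth≥ g G

{-# OPTIONS --safe #-}
-- Upper bound. On ℤ/(4b+1) draw an arc from i to i+b and to i+b+1. Sending i
-- to the interval [i, i+b) turns a homomorphism G → ℤ/(4b+1) into a b-fold
-- colouring with 4b+1 colours. Along a path of 4b edges, however oriented, the
-- two admissible steps differ by one, so the colours of the two ends can be
-- prescribed arbitrarily; hence vertices of degree at most 1 and the inner
-- vertices of such paths can be deleted. If neither occurs and the girth is at
-- least 24b, every face has at least six corners at vertices of degree at
-- least 3, which contradicts Euler's formula. Euler's formula is inherited by
-- subgraphs because adding an edge to a rotation system never increases
-- f - e - 2c.
--
-- Lower bound. Suppose k < 4b, so that no four colour sets are pairwise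
-- disjoint. Then in a path z₀ → z₁ ← z₂ → ⋯ with pendant directed paths,
-- vertices at even distance have intersecting colour sets and vertices at odd
-- distance have disjoint ones, so z₀ and z₂ₜ cannot be adjacent. An odd cycle
-- with pendant paths of length 2 is thus a witness of arbitrarily large girth.
module Submission where

-- An induced subgraph would need a new rotation system and new counts after every deletion. Instead
-- all darts and their rotation are kept, and a deleted edge becomes two fixed points of the edge
-- involution. A deleted vertex that has darts then survives as an isolated point with one face and
-- one component, so it adds 1 + 1 - 2 = 0 to v + f - 2c and cancels from Euler's formula. The
-- modulus 4b + 1 is fixed from two sides. A path of 4b edges realises 4b + 1 consecutive total
-- displacements, exactly one full residue system; and the orientation condition for intervals of
-- length b compares a number below 2b with one between 2b and 4b, which must stay distinct modulo
-- 4b + 1. In the lower bound, two colour sets are shown to meet by exhibiting two further sets,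
-- disjoint from each other and from both. The pendant paths supply the vertices for this; their
-- outer ends serve the odd distances. The fractional number is defined through minimal fold
-- numbers, so each colouring is first turned into a minimum by exhaustive search.

-- Finite cardinalities and numbers of equivalence classes.

module Counting where

  open import Defs using (Classes)
  open import Data.Bool.Base using (Bool; true; false; T; not)
  open import Data.Bool.Properties using (T-irrelevant)
  open import Data.Fin.Base using (Fin; zero; suc; punchIn; punchOut)
  open import Data.Fin.Properties using (_≟_; injective⇒≤; suc-injective; punchOut-cong; punchOut-injective; punchInᵢ≢i; punchOut-punchIn; +↔⊎)
  open import Data.List.Base using (List; []; _∷_)
  open import Data.List.Membership.Propositional using (_∈_)
  open import Data.List.Relation.Unary.Any using (here; there)
  open import Data.Nat.Base using (ℕ; zero; suc; _+_; _≤_)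
  import Data.Nat.Properties as ℕₚ
  open import Data.Product.Base using (Σ; ∃; _×_; _,_; proj₁; proj₂)
  open import Data.Sum.Base using (_⊎_; inj₁; inj₂)
  open import Data.Unit.Base using (tt)
  open import Function.Base using (_∘_)
  open import Function.Bundles using (_↔_; mk↔ₛ′; Inverse; mk⇔; Equivalence)
  open import Function.Properties.Inverse using (↔-trans)
  open import Level using (0ℓ)
  open import Relation.Binary.Core using (Rel)
  open import Relation.Binary.Structures using (IsEquivalence)
  open import Relation.Binary.PropositionalEquality
  open import Relation.Binary.Construct.Closure.Equivalence as Eq using (EqClosure)
  open import Relation.Nullary using (¬_; Dec; yes; no; contradiction)

  open import Algebra.Properties.CommutativeMonoid.Sum ℕₚ.+-0-commutativeMonoid public
    using (sum; sum-cong-≗; ∑-distrib-+; ∑-comm)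

  ⟦_⟧ : Bool → ℕ
  ⟦ true ⟧  = 1
  ⟦ false ⟧ = 0

  -- Turns a numerical sum into a set, so that inequalities between counts can be proved by
  -- injections.
  fin-sum : ∀ {n} (f : Fin n → ℕ) → Fin (sum f) ↔ Σ (Fin n) (Fin ∘ f)
  fin-sum {zero} f = mk↔ₛ′ (λ ()) (λ ()) (λ ()) (λ ())
  fin-sum {suc n} f = mk↔ₛ′ (to ∘ split.to) (split.from ∘ from) to-from from-to
    where
    module rest  = Inverse (fin-sum (f ∘ suc))
    module split = Inverse (+↔⊎ {f zero} {sum (f ∘ suc)})
    shift : Σ (Fin n) (Fin ∘ f ∘ suc) → Σ (Fin (suc n)) (Fin ∘ f)
    shift (i , j) = suc i , j
    to : Fin (f zero) ⊎ Fin (sum (f ∘ suc)) → Σ (Fin (suc n)) (Fin ∘ f)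
    to (inj₁ j) = zero , j
    to (inj₂ j) = shift (rest.to j)
    from : Σ (Fin (suc n)) (Fin ∘ f) → Fin (f zero) ⊎ Fin (sum (f ∘ suc))
    from (zero , j)  = inj₁ j
    from (suc i , j) = inj₂ (rest.from (i , j))
    to-from : ∀ x → to (split.to (split.from (from x))) ≡ x
    to-from x = trans (cong to (split.strictlyInverseˡ (from x))) (go x)
      where
      go : ∀ x → to (from x) ≡ x
      go (zero , j)  = refl
      go (suc i , j) = cong shift (rest.strictlyInverseˡ (i , j))
    from-to : ∀ x → split.from (from (to (split.to x))) ≡ x
    from-to x = trans (cong split.from (go (split.to x))) (split.strictlyInverseʳ x)
      where
      go : ∀ x → from (to x) ≡ x
      go (inj₁ j) = refl
      go (inj₂ j) = cong inj₂ (rest.strictlyInverseʳ j)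

  fin-⟦⟧ : ∀ b → Fin ⟦ b ⟧ ↔ T b
  fin-⟦⟧ true  = mk↔ₛ′ (λ _ → tt) (λ _ → zero) (λ _ → refl) (λ { zero → refl })
  fin-⟦⟧ false = mk↔ₛ′ (λ ()) (λ ()) (λ ()) (λ ())

  Σ-cong : ∀ {A : Set} {B C : A → Set} → (∀ a → B a ↔ C a) → Σ A B ↔ Σ A C
  Σ-cong e = mk↔ₛ′
    (λ (a , b) → a , Inverse.to (e a) b)
    (λ (a , c) → a , Inverse.from (e a) c)
    (λ (a , c) → cong (a ,_) (Inverse.strictlyInverseˡ (e a) c))
    (λ (a , b) → cong (a ,_) (Inverse.strictlyInverseʳ (e a) b))

  ↔-injective : ∀ {A B : Set} (e : A ↔ B) {x y} → Inverse.to e x ≡ Inverse.to e y → x ≡ y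
  ↔-injective e {x} {y} p =
    trans (sym (strictlyInverseʳ x)) (trans (cong from p) (strictlyInverseʳ y))
    where open Inverse e

  ↔-injective⁻ : ∀ {A B : Set} (e : A ↔ B) {x y} → Inverse.from e x ≡ Inverse.from e y → x ≡ y
  ↔-injective⁻ e {x} {y} p =
    trans (sym (strictlyInverseˡ x)) (trans (cong to p) (strictlyInverseˡ y))
    where open Inverse e

  subset-≡ : ∀ {n} {P : Fin n → Bool} {x y : Σ (Fin n) (T ∘ P)} → proj₁ x ≡ proj₁ y → x ≡ y
  subset-≡ refl = cong (_ ,_) (T-irrelevant _ _)

  count : ∀ {n} → (Fin n → Bool) → ℕ
  count P = sum (⟦_⟧ ∘ P)

  count₂ : ∀ {m n} → (Fin m → Fin n → Bool) → ℕ
  count₂ P = sum (count ∘ P)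

  fin-count : ∀ {n} (P : Fin n → Bool) → Fin (count P) ↔ Σ (Fin n) (T ∘ P)
  fin-count P = ↔-trans (fin-sum (⟦_⟧ ∘ P)) (Σ-cong (fin-⟦⟧ ∘ P))

  fin-count₂ : ∀ {m n} (P : Fin m → Fin n → Bool) →
               Fin (count₂ P) ↔ Σ (Fin m) λ x → Σ (Fin n) λ y → T (P x y)
  fin-count₂ P = ↔-trans (fin-sum (count ∘ P)) (Σ-cong (fin-count ∘ P))

  ≤-count : ∀ {m n} (P : Fin n → Bool) (f : Fin m → Σ (Fin n) (T ∘ P)) →
            (∀ {i j} → f i ≡ f j → i ≡ j) → m ≤ count P
  ≤-count P f inj = injective⇒≤ {f = from ∘ f} (inj ∘ ↔-injective⁻ (fin-count P))
    where open Inverse (fin-count P)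

  ≤-count₂ : ∀ {k m n} (P : Fin m → Fin n → Bool)
             (f : Fin k → Σ (Fin m) λ x → Σ (Fin n) λ y → T (P x y)) →
             (∀ {i j} → f i ≡ f j → i ≡ j) → k ≤ count₂ P
  ≤-count₂ P f inj = injective⇒≤ {f = from ∘ f} (inj ∘ ↔-injective⁻ (fin-count₂ P))
    where open Inverse (fin-count₂ P)

  count-≤ : ∀ {m n} (P : Fin n → Bool) (f : Σ (Fin n) (T ∘ P) → Fin m) →
            (∀ {x y} → f x ≡ f y → x ≡ y) → count P ≤ m
  count-≤ P f inj = injective⇒≤ {f = f ∘ to} (↔-injective (fin-count P) ∘ inj)
    where open Inverse (fin-count P)

  count-split : ∀ {n} (P : Fin n → Bool) → count P + count (not ∘ P) ≡ n
  count-split {zero}  P = refl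
  count-split {suc n} P with P zero
  ... | true  = cong suc (count-split (P ∘ suc))
  ... | false = trans (ℕₚ.+-suc _ _) (cong suc (count-split (P ∘ suc)))

  module _ {A : Set} {R : Rel A 0ℓ} {k : ℕ} (C : Classes R k) where

    cls : A → Fin k
    cls = proj₁ C

    rep : Fin k → A
    rep i = proj₁ (proj₁ (proj₂ C) i)

    cls-rep : ∀ i → cls (rep i) ≡ i
    cls-rep i = proj₂ (proj₁ (proj₂ C) i) refl

    cls⇒ : ∀ {x y} → cls x ≡ cls y → R x y
    cls⇒ = Equivalence.to (proj₂ (proj₂ C) _ _)

    cls⇐ : ∀ {x y} → R x y → cls x ≡ cls y
    cls⇐ = Equivalence.from (proj₂ (proj₂ C) _ _)

    rep-injective : ∀ {i j} → R (rep i) (rep j) → i ≡ j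
    rep-injective r = trans (sym (cls-rep _)) (trans (cls⇐ r) (cls-rep _))

    cls? : ∀ x y → Dec (R x y)
    cls? x y with cls x ≟ cls y
    ... | yes p = yes (cls⇒ p)
    ... | no ¬p = no (¬p ∘ cls⇐)

  -- For an equivalence `R` this is the equivalence generated by `R` and the pair `(a , b)`, in
  -- closed form: the classes of `a` and `b` become one.
  Glued : {A : Set} → Rel A 0ℓ → A → A → Rel A 0ℓ
  Glued R a b x y = R x y ⊎ ((R x a ⊎ R x b) × (R y a ⊎ R y b))

  glued-isEquivalence : ∀ {A : Set} {R : Rel A 0ℓ} → IsEquivalence R → ∀ a b → IsEquivalence (Glued R a b)
  glued-isEquivalence {R = R} equiv a b = record { refl = inj₁ E.refl ; sym = symm ; trans = tran }
    where
    module E = IsEquivalence equiv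
    near : ∀ {x y} → R x y → R y a ⊎ R y b → R x a ⊎ R x b
    near r (inj₁ s) = inj₁ (E.trans r s)
    near r (inj₂ s) = inj₂ (E.trans r s)
    symm : ∀ {x y} → Glued R a b x y → Glued R a b y x
    symm (inj₁ r)       = inj₁ (E.sym r)
    symm (inj₂ (m , n)) = inj₂ (n , m)
    tran : ∀ {x y z} → Glued R a b x y → Glued R a b y z → Glued R a b x z
    tran (inj₁ r)       (inj₁ s)       = inj₁ (E.trans r s)
    tran (inj₁ r)       (inj₂ (m , n)) = inj₂ (near r m , n)
    tran (inj₂ (m , n)) (inj₁ r)       = inj₂ (m , near (E.sym r) n)
    tran (inj₂ (m , _)) (inj₂ (_ , n)) = inj₂ (m , n)

  module _ {A : Set} {R R′ : Rel A 0ℓ} {k k′ : ℕ} (C : Classes R k) (C′ : Classes R′ k′) where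

    classes-antitone : (∀ {x y} → R x y → R′ x y) → k′ ≤ k
    classes-antitone sub = injective⇒≤ {f = cls C ∘ rep C′} (rep-injective C′ ∘ sub ∘ cls⇒ C)

    -- Set the `R′`-class of `a` aside. Among the other classes gluing identifies nothing, because
    -- it only joins the class of `b` to that of `a`; so they inject into the `R`-classes, and the
    -- class set aside accounts for `suc`.
    classes-glue : IsEquivalence R′ → ∀ {a b} → (∀ {x y} → R x y → Glued R′ a b x y) → k′ ≤ suc k
    classes-glue equiv {a} {b} glue = injective⇒≤ {f = f} f-injective
      where
      module E = IsEquivalence equiv
      f : Fin k′ → Fin (suc k)
      f i with cls C′ a ≟ i
      ... | yes _ = zero
      ... | no  _ = suc (cls C (rep C′ i))
      away : ∀ {i} → cls C′ a ≢ i → ¬ R′ (rep C′ i) a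
      away ne r = ne (trans (sym (cls⇐ C′ r)) (cls-rep C′ _))
      unglue : ∀ {x y} → Glued R′ a b x y → ¬ R′ x a → ¬ R′ y a → R′ x y
      unglue (inj₁ r)                 _ _ = r
      unglue (inj₂ (inj₁ r , _))      ¬r _ = contradiction r ¬r
      unglue (inj₂ (inj₂ _ , inj₁ r)) _ ¬r = contradiction r ¬r
      unglue (inj₂ (inj₂ r , inj₂ s)) _ _  = E.trans r (E.sym s)
      f-injective : ∀ {i j} → f i ≡ f j → i ≡ j
      f-injective {i} {j} eq with cls C′ a ≟ i | cls C′ a ≟ j
      ... | yes p | yes q = trans (sym p) q
      ... | no p  | no q  = rep-injective C′ (unglue (glue (cls⇒ C (suc-injective eq))) (away p) (away q))
      f-injective () | yes _ | no _
      f-injective () | no _  | yes _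

    -- The `R′`-class of `a` and `b` contains two different `R`-classes: it is sent to that of `b`,
    -- and the extra element to that of `a`. Every other `R′`-class goes to the `R`-class of its
    -- representative.
    classes-merge : ∀ {a b} → (∀ {x y} → R x y → R′ x y) → R′ a b → ¬ R a b → suc k′ ≤ k
    classes-merge {a} {b} sub r′ ¬r = injective⇒≤ {f = f} f-injective
      where
      f : Fin (suc k′) → Fin k
      f zero = cls C a
      f (suc i) with cls C′ b ≟ i
      ... | yes _ = cls C b
      ... | no  _ = cls C (rep C′ i)
      off : ∀ {i} → cls C′ b ≢ i → cls C a ≢ cls C (rep C′ i)
      off ne p = ne (trans (sym (cls⇐ C′ r′)) (trans (cls⇐ C′ (sub (cls⇒ C p))) (cls-rep C′ _)))
      off′ : ∀ {i} → cls C′ b ≢ i → cls C b ≢ cls C (rep C′ i)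
      off′ ne p = ne (trans (cls⇐ C′ (sub (cls⇒ C p))) (cls-rep C′ _))
      f-injective : ∀ {i j} → f i ≡ f j → i ≡ j
      f-injective {zero} {zero} eq = refl
      f-injective {zero} {suc j} eq with cls C′ b ≟ j
      ... | yes _ = contradiction (cls⇒ C eq) ¬r
      ... | no ne = contradiction eq (off ne)
      f-injective {suc i} {zero} eq with cls C′ b ≟ i
      ... | yes _ = contradiction (cls⇒ C (sym eq)) ¬r
      ... | no ne = contradiction (sym eq) (off ne)
      f-injective {suc i} {suc j} eq with cls C′ b ≟ i | cls C′ b ≟ j
      ... | yes p | yes q = cong suc (trans (sym p) q)
      ... | yes p | no ne = contradiction eq (off′ ne)
      ... | no ne | yes q = contradiction (sym eq) (off′ ne)
      ... | no _  | no _  = cong suc (rep-injective C′ (sub (cls⇒ C eq)))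

  classes-cong : ∀ {A : Set} {R R′ : Rel A 0ℓ} {k} → (∀ {x y} → R x y → R′ x y) → (∀ {x y} → R′ x y → R x y) →
                 Classes R k → Classes R′ k
  classes-cong to from C = cls C , proj₁ (proj₂ C) , λ x y → mk⇔ (to ∘ cls⇒ C) (cls⇐ C ∘ from)

  Generated : {A : Set} → List (A × A) → Rel A 0ℓ
  Generated ps = EqClosure λ x y → (x , y) ∈ ps

  classes-↔ : ∀ {A : Set} {n} → A ↔ Fin n → Classes {A} _≡_ n
  classes-↔ e = to , (λ i → from i , λ { refl → strictlyInverseˡ i }) , λ x y → mk⇔ (↔-injective e) (cong to)
    where open Inverse e

  -- Starting from equality, each generating pair glues at most two classes.
  classes-generated : ∀ {A : Set} {n} → A ↔ Fin n → (ps : List (A × A)) → ∃ (Classes (Generated ps))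
  classes-generated e [] = _ , proj₁ C₀ , proj₁ (proj₂ C₀) , λ x y → mk⇔ (λ p → Eq.reflexive _ ◅≡ cls⇒ C₀ p) (from ∘ flat)
    where
    C₀ = classes-↔ e
    from : ∀ {x y} → x ≡ y → cls C₀ x ≡ cls C₀ y
    from = cls⇐ C₀
    _◅≡_ : ∀ {x y} → Generated [] x x → x ≡ y → Generated [] x y
    r ◅≡ refl = r
    flat : ∀ {x y} → Generated [] x y → x ≡ y
    flat = Eq.fold isEquivalence λ ()
  classes-generated {A} e ((a , b) ∷ ps) with classes-generated e ps
  ... | zero , C = contradiction (cls C a) λ ()
  ... | suc k , C with cls C a ≟ cls C b
  ...   | yes a≡b = suc k , cls C , proj₁ (proj₂ C) , λ x y → mk⇔ (Eq.map there ∘ cls⇒ C) (cls⇐′ x y)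
    where
    kernel : IsEquivalence (λ x y → cls C x ≡ cls C y)
    kernel = record { refl = refl ; sym = sym ; trans = trans }
    cls⇐′ : ∀ x y → Generated ((a , b) ∷ ps) x y → cls C x ≡ cls C y
    cls⇐′ x y = Eq.fold kernel λ { (here refl) → a≡b ; (there p) → cls⇐ C (Eq.return p) }
  ...   | no a≢b = k , c , surj , λ x y → mk⇔ (c⇒ x y) (c⇐ x y)
    where
    b≢a = a≢b ∘ sym
    c : A → Fin k
    c x with cls C b ≟ cls C x
    ... | yes _ = punchOut b≢a
    ... | no ne = punchOut ne
    surj : ∀ i → ∃ λ x → ∀ {z} → z ≡ x → c z ≡ i
    surj i = rep C j , λ { refl → lemma }
      where
      j = punchIn (cls C b) i
      lemma : c (rep C j) ≡ i
      lemma with cls C b ≟ cls C (rep C j)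
      ... | yes p = contradiction (sym (trans p (cls-rep C j))) (punchInᵢ≢i (cls C b) i)
      ... | no ne = trans (punchOut-cong (cls C b) {i≢k = λ p → punchInᵢ≢i (cls C b) i (sym p)} (cls-rep C j)) (punchOut-punchIn (cls C b))
    lift : ∀ {x y} → cls C x ≡ cls C y → Generated ((a , b) ∷ ps) x y
    lift p = Eq.map there (cls⇒ C p)
    ab : Generated ((a , b) ∷ ps) a b
    ab = Eq.return (here refl)
    c⇒ : ∀ x y → c x ≡ c y → Generated ((a , b) ∷ ps) x y
    c⇒ x y eq with cls C b ≟ cls C x | cls C b ≟ cls C y
    ... | yes p | yes q = lift (trans (sym p) q)
    ... | yes p | no q  = Eq.transitive _ (lift (sym p)) (Eq.transitive _ (Eq.symmetric _ ab) (lift (punchOut-injective b≢a q eq)))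
    ... | no p  | yes q = Eq.transitive _ (lift (punchOut-injective p b≢a eq)) (Eq.transitive _ ab (lift q))
    ... | no p  | no q  = lift (punchOut-injective p q eq)
    c-cong : ∀ {x y} → cls C x ≡ cls C y → c x ≡ c y
    c-cong {x} {y} eq with cls C b ≟ cls C x | cls C b ≟ cls C y
    ... | yes p | yes q = refl
    ... | yes p | no q  = contradiction (trans p eq) q
    ... | no p  | yes q = contradiction (trans q (sym eq)) p
    ... | no p  | no q  = punchOut-cong (cls C b) eq
    c-ab : c a ≡ c b
    c-ab with cls C b ≟ cls C a | cls C b ≟ cls C b
    ... | yes p | _     = contradiction p b≢a
    ... | no p  | yes q = punchOut-cong (cls C b) refl
    ... | no p  | no q  = contradiction refl q
    kernel : IsEquivalence (λ x y → c x ≡ c y)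
    kernel = record { refl = refl ; sym = sym ; trans = trans }
    c⇐ : ∀ x y → Generated ((a , b) ∷ ps) x y → c x ≡ c y
    c⇐ x y = Eq.fold kernel λ { (here refl) → c-ab ; (there p) → c-cong (cls⇐ C (Eq.return p)) }

-- Combinatorial maps given by permutations of darts, and the effect of adding edges.

module Maps where

  open import Defs using (Classes; SameOrbit)
  open Counting
  open import Data.Bool.Base using (Bool; true; false; _∨_; if_then_else_)
  open import Data.Bool.Properties using (∨-zeroʳ)
  open import Data.Fin.Base using (Fin; toℕ)
  open import Data.Fin.Properties using (pigeonhole; _≟_)
  open import Data.List.Base using (List; []; _∷_; map; _++_; length; allFin)
  open import Data.List.Membership.Propositional using (_∈_)
  open import Data.List.Membership.Propositional.Properties using (∈-map⁺; ∈-map⁻; ∈-++⁺ˡ; ∈-++⁺ʳ; ∈-++⁻; ∈-allFin)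
  open import Data.List.Relation.Unary.Any using (here; there)
  open import Data.Nat.Base using (zero; suc; _+_; _*_; _≤_; s≤s)
  open import Data.Nat.GeneralisedArithmetic using (fold)
  open import Data.Nat.Properties hiding (_≟_)
  open import Data.Nat.Tactic.RingSolver using (solve-∀)
  open import Data.Product.Base using (∃; _×_; _,_; proj₁; proj₂)
  open import Data.Sum.Base using (_⊎_; inj₁; inj₂)
  open import Function.Base using (_∘_)
  open import Function.Bundles using (_↔_; Inverse)
  open import Level using (0ℓ)
  open import Relation.Binary.Core using (Rel)
  open import Relation.Binary.Definitions using (DecidableEquality)
  open import Relation.Binary.PropositionalEquality
  open import Relation.Binary.Construct.Closure.Equivalence as Eq using (EqClosure)
  open import Relation.Nullary using (¬_; yes; no; does)
  open import Relation.Nullary.Decidable using (dec-true; dec-false)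

  Finite : Set → Set
  Finite A = ∃ λ n → A ↔ Fin n

  module _ {A : Set} (finite : Finite A) where
    open Inverse (proj₂ finite)

    finite-≟ : DecidableEquality A
    finite-≟ x y with to x ≟ to y
    ... | yes p = yes (↔-injective (proj₂ finite) p)
    ... | no ¬p = no (¬p ∘ cong to)

    elements : List A
    elements = map from (allFin (proj₁ finite))

    ∈-elements : ∀ x → x ∈ elements
    ∈-elements x = subst (_∈ elements) (strictlyInverseʳ x) (∈-map⁺ from (∈-allFin (to x)))

    -- Two iterates coincide by the pigeonhole principle, and injectivity cancels their common
    -- initial steps. Backward steps of a permutation can thus be replaced by forward ones.
    periodic : (f : A → A) → (∀ {x y} → f x ≡ f y → x ≡ y) → ∀ x → ∃ λ m → fold x f (suc m) ≡ x
    periodic f f-inj x with pigeonhole (n<1+n (proj₁ finite)) (λ i → to (fold x f (toℕ i)))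
    ... | i , j , i<j , eq with m≤n⇒∃[o]m+o≡n i<j
    ... | o , refl′ = o , cancel (toℕ i) (trans (cong (fold x f) refl″) (sym (↔-injective (proj₂ finite) eq)))
      where
      refl″ : toℕ i + suc o ≡ toℕ j
      refl″ = trans (+-suc (toℕ i) o) refl′
      cancel : ∀ i → fold x f (i + suc o) ≡ fold x f i → fold x f (suc o) ≡ x
      cancel zero    p = p
      cancel (suc i) p = cancel i (f-inj p)

    classes-orbits : (f : A → A) → ∃ (Classes (SameOrbit f))
    classes-orbits f with classes-generated (proj₂ finite) (map (λ x → x , f x) elements)
    ... | k , C = k , classes-cong (Eq.map to′) (Eq.map from′) C
      where
      to′ : ∀ {x y} → (x , y) ∈ map (λ x → x , f x) elements → f x ≡ y
      to′ p with ∈-map⁻ (λ x → x , f x) p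
      ... | _ , _ , refl = refl
      from′ : ∀ {x y} → f x ≡ y → (x , y) ∈ map (λ x → x , f x) elements
      from′ {x} refl = ∈-map⁺ (λ x → x , f x) (∈-elements x)

  -- The permutation encoding of a map on a surface: `σ` turns around vertices, `β` exchanges the
  -- ends of edges, and the orbits of `σ ∘ β` are the faces. The rotation `σ` is fixed; only `β`
  -- varies.
  module Map {D : Set} (fin : Finite D) (σ : D → D) (σ-injective : ∀ {x y} → σ x ≡ σ y → x ≡ y) where

    Face : (D → D) → Rel D 0ℓ
    Face β = SameOrbit (σ ∘ β)

    Link : (D → D) → Rel D 0ℓ
    Link β x y = σ x ≡ y ⊎ β x ≡ y

    Component : (D → D) → Rel D 0ℓ
    Component β = EqClosure (Link β)

    faces : ∀ β → ∃ (Classes (Face β))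
    faces β = classes-orbits fin (σ ∘ β)

    components : ∀ β → ∃ (Classes (Component β))
    components β with classes-generated (proj₂ fin) (map (λ x → x , σ x) (elements fin) ++ map (λ x → x , β x) (elements fin))
    ... | k , C = k , classes-cong (Eq.map to) (Eq.map from) C
      where
      via : (D → D) → D → D × D
      via f x = x , f x
      pairs = map (via σ) (elements fin) ++ map (via β) (elements fin)
      to : ∀ {x y} → (x , y) ∈ pairs → Link β x y
      to p with ∈-++⁻ (map (via σ) (elements fin)) p
      ... | inj₁ q with ∈-map⁻ (via σ) q
      ...   | _ , _ , refl = inj₁ refl
      to p | inj₂ q with ∈-map⁻ (via β) q
      ...   | _ , _ , refl = inj₂ refl
      from : ∀ {x y} → Link β x y → (x , y) ∈ pairs
      from {x} (inj₁ refl) = ∈-++⁺ˡ (∈-map⁺ (via σ) (∈-elements fin x))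
      from {x} (inj₂ refl) = ∈-++⁺ʳ _ (∈-map⁺ (via β) (∈-elements fin x))

    face⇒component : ∀ {β x y} → Face β x y → Component β x y
    face⇒component = Eq.fold (Eq.isEquivalence _) λ { refl → Eq.transitive _ (Eq.return (inj₂ refl)) (Eq.return (inj₁ refl)) }

    -- Adding the edge {d, d′} to a map whose edges are the 2-cycles of β.
    module AddEdge {β β′ : D → D} {d d′ : D}
      (β-injective : ∀ {x y} → β x ≡ β y → x ≡ y)
      (βd : β d ≡ d) (βd′ : β d′ ≡ d′) (β′d : β′ d ≡ d′) (β′d′ : β′ d′ ≡ d)
      (agree : ∀ {x} → x ≢ d → x ≢ d′ → β′ x ≡ β x) where

      φ φ′ : D → D
      φ  = σ ∘ β
      φ′ = σ ∘ β′

      -- With `agree` this says that `φ′` is `φ` composed with the transposition of `d` and `d′`, so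
      -- that either one face splits or two faces merge.
      φ′d : φ′ d ≡ φ d′
      φ′d = cong σ (trans β′d (sym βd′))

      φ′d′ : φ′ d′ ≡ φ d
      φ′d′ = cong σ (trans β′d′ (sym βd))

      glue-face : ∀ {x y} → Face β x y → Glued (Face β′) d d′ x y
      glue-face = Eq.fold (glued-isEquivalence (Eq.isEquivalence _) d d′) gen
        where
        gen : ∀ {x y} → φ x ≡ y → Glued (Face β′) d d′ x y
        gen {x} refl with finite-≟ fin x d | finite-≟ fin x d′
        ... | yes refl | _        = inj₂ (inj₁ (Eq.reflexive _) , inj₂ (Eq.symmetric _ (Eq.return φ′d′)))
        ... | no _     | yes refl = inj₂ (inj₂ (Eq.reflexive _) , inj₁ (Eq.symmetric _ (Eq.return φ′d)))
        ... | no x≢d   | no x≢d′  = inj₁ (Eq.return (cong σ (agree x≢d x≢d′)))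

      glue-component : ∀ {x y} → Component β′ x y → Glued (Component β) d d′ x y
      glue-component = Eq.fold (glued-isEquivalence (Eq.isEquivalence _) d d′) gen
        where
        gen : ∀ {x y} → Link β′ x y → Glued (Component β) d d′ x y
        gen (inj₁ p) = inj₁ (Eq.return (inj₁ p))
        gen {x} (inj₂ refl) with finite-≟ fin x d | finite-≟ fin x d′
        ... | yes refl | _        = inj₂ (inj₁ (Eq.reflexive _) , inj₂ (subst (λ z → Component β z d′) (sym β′d) (Eq.reflexive _)))
        ... | no _     | yes refl = inj₂ (inj₂ (Eq.reflexive _) , inj₁ (subst (λ z → Component β z d) (sym β′d′) (Eq.reflexive _)))
        ... | no x≢d   | no x≢d′  = inj₁ (Eq.return (inj₂ (sym (agree x≢d x≢d′))))

      component⊇ : Component β d d′ → ∀ {x y} → Component β′ x y → Component β x y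
      component⊇ dd′ r with glue-component r
      ... | inj₁ s       = s
      ... | inj₂ (m , n) = Eq.transitive _ (near m) (Eq.symmetric _ (near n))
        where
        near : ∀ {x} → Component β x d ⊎ Component β x d′ → Component β x d′
        near (inj₁ s) = Eq.transitive _ s dd′
        near (inj₂ s) = s

      -- Follow the φ-orbit of d′: φ′ enters it from d and then agrees with φ
      -- until d′ is reached.
      joined : ¬ Face β d d′ → Face β′ d d′
      joined ¬dd′ with periodic fin φ (β-injective ∘ σ-injective) d′
      ... | m , back = walk m back (Eq.reflexive _)
        where
        shift : ∀ m x → fold x φ (suc m) ≡ fold (φ x) φ m
        shift zero    x = refl
        shift (suc m) x = cong φ (shift m x)
        advance : ∀ {x} → Face β d′ x → x ≢ d′ → φ′ x ≡ φ x
        advance r x≢d′ = cong σ (agree (λ { refl → ¬dd′ (Eq.symmetric _ r) }) x≢d′)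
        continue : ∀ m x → Face β d′ x → fold x φ m ≡ d′ → Face β′ d x → Face β′ d d′
        continue zero    x _ refl s = s
        continue (suc m) x r p s with finite-≟ fin x d′
        ... | yes refl = s
        ... | no x≢d′  = continue m (φ x) (Eq.transitive _ r (Eq.return refl)) (trans (sym (shift m x)) p)
                           (Eq.transitive _ s (Eq.return (advance r x≢d′)))
        walk : ∀ m → fold d′ φ (suc m) ≡ d′ → Face β d′ d′ → Face β′ d d′
        walk m p r = continue m (φ d′) (Eq.return refl) (trans (sym (shift m d′)) p) (Eq.return φ′d)

      face⊆ : Face β′ d d′ → ∀ {x y} → Face β x y → Face β′ x y
      face⊆ dd′ r with glue-face r
      ... | inj₁ s       = s
      ... | inj₂ (m , n) = Eq.transitive _ (near m) (Eq.symmetric _ (near n))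
        where
        near : ∀ {x} → Face β′ x d ⊎ Face β′ x d′ → Face β′ x d′
        near (inj₁ s) = Eq.transitive _ s dd′
        near (inj₂ s) = s

      -- If both ends already lie in one component, the components are unchanged and at most one
      -- face is gained. Otherwise `d` and `d′` lie on different faces, which merge; losing a face
      -- and gaining an edge pays for the lost component, which has weight 2.
      add-edge : ∀ {f c f′ c′} → Classes (Face β) f → Classes (Component β) c →
                 Classes (Face β′) f′ → Classes (Component β′) c′ → f′ + 2 * c ≤ suc f + 2 * c′
      add-edge {f} {c} {f′} {c′} F C F′ C′ with cls? C d d′
      ... | yes dd′ = +-mono-≤ (classes-glue F F′ (Eq.isEquivalence _) glue-face)
                               (*-monoʳ-≤ 2 (classes-antitone C′ C (component⊇ dd′)))
      ... | no ¬dd′ = begin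
        f′ + 2 * c         ≤⟨ +-monoʳ-≤ f′ (*-monoʳ-≤ 2 (classes-glue C′ C (Eq.isEquivalence _) glue-component)) ⟩
        f′ + 2 * suc c′    ≡⟨ lemma f′ c′ ⟩
        suc (suc f′ + 2 * c′) ≤⟨ s≤s (+-monoˡ-≤ (2 * c′) (classes-merge F F′ (face⊆ dd″) dd″ ¬face)) ⟩
        suc f + 2 * c′     ∎
        where
        open ≤-Reasoning
        lemma : ∀ x y → x + 2 * suc y ≡ suc (suc x + 2 * y)
        lemma = solve-∀
        ¬face : ¬ Face β d d′
        ¬face = ¬dd′ ∘ face⇒component
        dd″ : Face β′ d d′
        dd″ = joined ¬face

    module Edges (α : D → D) (α-involutive : ∀ d → α (α d) ≡ d) where

      -- Darts outside S become half-edges, that is, fixed points.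
      part : (D → Bool) → D → D
      part S d = if S d then α d else d

      Closed : (D → Bool) → Set
      Closed S = ∀ d → S (α d) ≡ S d

      part-injective : ∀ {S} → Closed S → ∀ {x y} → part S x ≡ part S y → x ≡ y
      part-injective {S} S-closed {x} {y} p = trans (sym (inv x)) (trans (cong (part S) p) (inv y))
        where
        inv : ∀ x → part S (part S x) ≡ x
        inv x with S x in eq
        ... | true  rewrite S-closed x | eq = α-involutive x
        ... | false rewrite eq = refl

      _≟ᵈ_ : DecidableEquality D
      _≟ᵈ_ = finite-≟ fin

      add : (D → Bool) → D → D → Bool
      add S d x = S x ∨ does (x ≟ᵈ d) ∨ does (x ≟ᵈ α d)

      add-⊇ : ∀ S d {x} → S x ≡ true → add S d x ≡ true
      add-⊇ S d p rewrite p = refl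

      add-∋ : ∀ S d → add S d d ≡ true
      add-∋ S d rewrite dec-true (d ≟ᵈ d) refl = ∨-zeroʳ (S d)

      add-∋α : ∀ S d → add S d (α d) ≡ true
      add-∋α S d rewrite dec-true (α d ≟ᵈ α d) refl | ∨-zeroʳ (does (α d ≟ᵈ d)) = ∨-zeroʳ (S (α d))

      add-other : ∀ S d {x} → x ≢ d → x ≢ α d → add S d x ≡ S x
      add-other S d {x} p q rewrite dec-false (x ≟ᵈ d) p | dec-false (x ≟ᵈ α d) q with S x
      ... | true  = refl
      ... | false = refl

      add-closed : ∀ {S} → Closed S → ∀ d → Closed (add S d)
      add-closed {S} S-closed d x with x ≟ᵈ d | x ≟ᵈ α d
      ... | yes refl | _        = trans (add-∋α S x) (sym (∨-zeroʳ (S x)))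
      ... | no _     | yes refl = trans (cong (add S d) (α-involutive d)) (trans (add-∋ S d) (sym (∨-zeroʳ (S (α d)))))
      ... | no p     | no q     = trans (add-other S d p′ q′) (trans (S-closed x) (sym (∨-f (S x))))
        where
        p′ : α x ≢ d
        p′ r = q (trans (sym (α-involutive x)) (cong α r))
        q′ : α x ≢ α d
        q′ r = p (trans (sym (α-involutive x)) (trans (cong α r) (α-involutive d)))
        ∨-f : ∀ b → b ∨ false ≡ b
        ∨-f true  = refl
        ∨-f false = refl

      addAll : (D → Bool) → List D → D → Bool
      addAll S []       = S
      addAll S (d ∷ ds) = addAll (add S d) ds

      addAll-⊇ : ∀ S ds {x} → S x ≡ true → addAll S ds x ≡ true
      addAll-⊇ S []       p = p
      addAll-⊇ S (d ∷ ds) p = addAll-⊇ (add S d) ds (add-⊇ S d p)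

      addAll-∋ : ∀ S ds {x} → x ∈ ds ⊎ α x ∈ ds → addAll S ds x ≡ true
      addAll-∋ S (d ∷ ds) (inj₁ (here refl)) = addAll-⊇ (add S d) ds (add-∋ S d)
      addAll-∋ S (d ∷ ds) {x} (inj₂ (here refl)) = addAll-⊇ (add S d) ds (trans (sym (cong (add S (α x)) (α-involutive x))) (add-∋α S (α x)))
      addAll-∋ S (d ∷ ds) (inj₁ (there p)) = addAll-∋ (add S d) ds (inj₁ p)
      addAll-∋ S (d ∷ ds) (inj₂ (there p)) = addAll-∋ (add S d) ds (inj₂ p)

      part-true : ∀ S {x} → S x ≡ true → part S x ≡ α x
      part-true S p rewrite p = refl

      part-false : ∀ S {x} → S x ≡ false → part S x ≡ x
      part-false S p rewrite p = refl

      part-add : ∀ S d {x} → add S d x ≡ S x → part (add S d) x ≡ part S x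
      part-add S d {x} p = cong (λ b → if b then α x else x) p

      same-face : ∀ {β β′} → (∀ x → β x ≡ β′ x) → ∀ {x y} → Face β x y → Face β′ x y
      same-face eq = Eq.map λ {x} p → trans (cong σ (sym (eq x))) p

      same-component : ∀ {β β′} → (∀ x → β x ≡ β′ x) → ∀ {x y} → Component β x y → Component β′ x y
      same-component eq = Eq.map λ { (inj₁ p) → inj₁ p ; {x} (inj₂ p) → inj₂ (trans (sym (eq x)) p) }

      add-one : ∀ {S f c f′ c′} → Closed S → ∀ d → Classes (Face (part S)) f → Classes (Component (part S)) c →
                Classes (Face (part (add S d))) f′ → Classes (Component (part (add S d))) c′ → f′ + 2 * c ≤ suc f + 2 * c′
      add-one {S} S-closed d F C F′ C′ with S d in eq
      ... | true = m≤n⇒m≤1+n (+-mono-≤ (classes-antitone F F′ (same-face same))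
                                       (*-monoʳ-≤ 2 (classes-antitone C′ C (same-component (sym ∘ same)))))
        where
        same : ∀ x → part S x ≡ part (add S d) x
        same x with x ≟ᵈ d | x ≟ᵈ α d
        ... | yes refl | _ = trans (part-true S eq) (sym (cong (λ b → if b then α x else x) (∨-zeroʳ (S x))))
        ... | no _ | yes refl = trans (part-true S (trans (S-closed d) eq)) (sym (cong (λ b → if b then α x else x) (∨-zeroʳ (S x))))
        ... | no p | no q = cong (λ b → if b then α x else x) (lemma (S x))
          where
          lemma : ∀ b → b ≡ b ∨ false
          lemma true  = refl
          lemma false = refl
      ... | false = AddEdge.add-edge {β = part S} {β′ = part (add S d)} {d = d} {d′ = α d} (part-injective S-closed)
            (part-false S eq) (part-false S (trans (S-closed d) eq))
            (part-true (add S d) (add-∋ S d))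
            (trans (part-true (add S d) (add-∋α S d)) (α-involutive d))
            (λ p q → part-add S d (add-other S d p q)) F C F′ C′

      add-all : ∀ {S f c f′ c′} → Closed S → ∀ ds → Classes (Face (part S)) f → Classes (Component (part S)) c →
                Classes (Face (part (addAll S ds))) f′ → Classes (Component (part (addAll S ds))) c′ →
                f′ + 2 * c ≤ f + length ds + 2 * c′
      add-all {f = f} {c} {f′} {c′} S-closed [] F C F′ C′ rewrite +-identityʳ f =
        +-mono-≤ (classes-antitone F F′ (λ r → r)) (*-monoʳ-≤ 2 (classes-antitone C′ C (λ r → r)))
      -- The term `2 * c″` of the intermediate map occurs on opposite sides of the two inequalities,
      -- so it is added first and cancelled at the end.
      add-all {S} {f} {c} {f′} {c′} S-closed (d ∷ ds) F C F′ C′ = +-cancelʳ-≤ (2 * c″) _ _ (begin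
        f′ + 2 * c + 2 * c″                   ≡⟨ swap f′ (2 * c) (2 * c″) ⟩
        f′ + 2 * c″ + 2 * c                   ≤⟨ +-monoˡ-≤ (2 * c) (add-all (add-closed S-closed d) ds (proj₂ F″) (proj₂ C″) F′ C′) ⟩
        f″ + length ds + 2 * c′ + 2 * c       ≡⟨ shuffle f″ (length ds) (2 * c′) (2 * c) ⟩
        (f″ + 2 * c) + (length ds + 2 * c′)   ≤⟨ +-monoˡ-≤ (length ds + 2 * c′) (add-one S-closed d F C (proj₂ F″) (proj₂ C″)) ⟩
        (suc f + 2 * c″) + (length ds + 2 * c′) ≡⟨ finish f (2 * c″) (length ds) (2 * c′) ⟩
        f + suc (length ds) + 2 * c′ + 2 * c″ ∎)
        where
        open ≤-Reasoning
        F″ = faces (part (add S d))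
        C″ = components (part (add S d))
        f″ = proj₁ F″
        c″ = proj₁ C″
        swap : ∀ x y z → x + y + z ≡ x + z + y
        swap = solve-∀
        shuffle : ∀ x y z w → x + y + z + w ≡ (x + w) + (y + z)
        shuffle = solve-∀
        finish : ∀ x y z w → (suc x + y) + (z + w) ≡ x + suc z + w + y
        finish = solve-∀

      -- Listing either dart of an edge suffices, so `ds` may have one entry per missing edge and
      -- its length is then the number of edges added.
      submap : ∀ {S f c f′ c′} → Closed S → ∀ ds → (∀ x → S x ≡ true ⊎ (x ∈ ds ⊎ α x ∈ ds)) →
               Classes (Face (part S)) f → Classes (Component (part S)) c →
               Classes (Face α) f′ → Classes (Component α) c′ → f′ + 2 * c ≤ f + length ds + 2 * c′
      submap {S} S-closed ds complete F C F′ C′ =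
        add-all S-closed ds F C (classes-cong (same-face (sym ∘ full)) (same-face full) F′)
                                (classes-cong (same-component (sym ∘ full)) (same-component full) C′)
        where
        full : ∀ x → part (addAll S ds) x ≡ α x
        full x with complete x
        ... | inj₁ p = part-true (addAll S ds) (addAll-⊇ S ds p)
        ... | inj₂ p = part-true (addAll S ds) (addAll-∋ S ds p)

-- Rotation systems as combinatorial maps; Euler's inequality for induced subgraphs.

module Surfaces where

  open import Defs hiding (_≤_)
  open Counting
  open Maps
  open import Data.Bool.Base using (Bool; true; false; _∧_; not; T; if_then_else_)
  open import Data.Bool.Properties using (T-irrelevant; ∧-comm)
  open import Data.Fin.Base using (Fin; zero; suc)
  open import Data.Fin.Properties using (+↔⊎)
  open import Data.List.Base using (List; length; tabulate)
  open import Data.List.Membership.Propositional using (_∈_)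
  open import Data.List.Membership.Propositional.Properties using (∈-tabulate⁺)
  open import Data.List.Properties using (length-tabulate)
  open import Data.Maybe.Base using (Maybe; just; nothing)
  open import Data.Maybe.Properties using (just-injective)
  open import Data.Nat.Base using (ℕ; zero; suc; _+_; _*_; _≤_)
  open import Data.Nat.GeneralisedArithmetic using (fold)
  open import Data.Nat.Properties hiding (_≟_)
  open import Data.Nat.Tactic.RingSolver using (solve-∀)
  open import Data.Product.Base using (Σ; ∃; _×_; _,_; proj₁; proj₂)
  open import Data.Sum.Base using (_⊎_; inj₁; inj₂)
  open import Function.Base using (_∘_; _on_)
  open import Data.Sum.Function.Propositional using (_⊎-↔_)
  open import Function.Properties.Inverse using (↔-trans; ↔-sym)
  open import Function.Bundles using (_↔_; mk↔ₛ′; Inverse)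
  open import Relation.Binary.PropositionalEquality
  open import Relation.Binary.Construct.Closure.Equivalence as Eq using (EqClosure)
  open import Relation.Binary.Construct.Closure.ReflexiveTransitive using (Star; ε; _◅_)
  open import Relation.Binary.Construct.Closure.Symmetric as Sym using (fwd; bwd)
  open import Relation.Nullary using (¬_; contradiction)

  module _ (G : OrientedGraph) where
    open OrientedGraph G
    open Dart

    loopless : ∀ {x} → ¬ x ~ x
    loopless (fwd a) = asym a a
    loopless (bwd a) = asym a a

    ~-sym : ∀ {x y} → x ~ y → y ~ x
    ~-sym = Sym.symmetric _⟶_

    -- Asymmetry allows only one direction between two vertices. Hence a dart is determined by its
    -- ends.
    ~-irrelevant : ∀ {x y} (p q : x ~ y) → p ≡ q
    ~-irrelevant (fwd a) (fwd b) = cong fwd (T-irrelevant a b)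
    ~-irrelevant (fwd a) (bwd b) = contradiction b (asym a)
    ~-irrelevant (bwd a) (fwd b) = contradiction b (asym a)
    ~-irrelevant (bwd a) (bwd b) = cong bwd (T-irrelevant a b)

    dart-≡ : ∀ {d d′ : Dart G} → tail d ≡ tail d′ → head d ≡ head d′ → d ≡ d′
    dart-≡ {dart x y p} {dart .x .y q} refl refl = cong (dart x y) (~-irrelevant p q)

    Arc : (V → V → Bool) → Set
    Arc P = Σ V λ x → Σ V λ y → T (P x y)

    dart↔arc⊎arc : Dart G ↔ (Arc arc ⊎ Arc arc)
    dart↔arc⊎arc = mk↔ₛ′ to from
      (λ { (inj₁ _) → refl ; (inj₂ _) → refl })
      (λ { (dart _ _ (fwd _)) → refl ; (dart _ _ (bwd _)) → refl })
      where
      to : Dart G → Arc arc ⊎ Arc arc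
      to (dart x y (fwd a)) = inj₁ (x , y , a)
      to (dart x y (bwd a)) = inj₂ (y , x , a)
      from : Arc arc ⊎ Arc arc → Dart G
      from (inj₁ (x , y , a)) = dart x y (fwd a)
      from (inj₂ (y , x , a)) = dart x y (bwd a)

    finite-dart : Finite (Dart G)
    finite-dart = _ , ↔-trans dart↔arc⊎arc (↔-trans (↔-sym (fin-count₂ arc) ⊎-↔ ↔-sym (fin-count₂ arc)) (↔-sym +↔⊎))

  T⇒true : ∀ {b} → T b → b ≡ true
  T⇒true {true} _ = refl

  true⇒T : ∀ {b} → b ≡ true → T b
  true⇒T refl = _

  ∧-true : ∀ {a b} → a ∧ b ≡ true → a ≡ true × b ≡ true
  ∧-true {true} {true} _ = refl , refl

  module Surface (G : OrientedGraph) (R : RotationSystem G) where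
    open OrientedGraph G
    open RotationSystem R
    open Dart

    -- By definition `next` is `σ ∘ reverse`, so the faces counted in `Spherical` are those of the
    -- map with edge involution `reverse`.
    σ : Dart G → Dart G
    σ (dart x y p) = dart x (rot x y) (closed p)

    -- The path from `rot x z` to `z` provided by `cyclic` ends with a step into `z`, unless it is
    -- empty and `z` is its own successor.
    σ⁻ : ∀ d → ∃ λ d′ → σ d′ ≡ d
    σ⁻ (dart x z p) with last-step (closed p) (cyclic (closed p) p)
      where
      last-step : ∀ {y} → x ~ y → Star (λ u v → rot x u ≡ v) y z → y ≡ z ⊎ ∃ λ u → x ~ u × rot x u ≡ z
      last-step q ε = inj₁ refl
      last-step {y} q (refl ◅ s) with last-step (closed q) s
      ... | inj₁ e = inj₂ (y , q , e)
      ... | inj₂ r = inj₂ r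
    ... | inj₁ e           = dart x z p , dart-≡ G refl e
    ... | inj₂ (u , q , e) = dart x u q , dart-≡ G refl e

    -- A surjection of a finite set is injective, since its section is.
    σ-injective : ∀ {d d′} → σ d ≡ σ d′ → d ≡ d′
    σ-injective {d} {d′} p with onto d | onto d′
      where
      s : Dart G → Dart G
      s = proj₁ ∘ σ⁻
      onto : ∀ d → ∃ λ c → s c ≡ d
      onto d with periodic (finite-dart G) s (λ {x} {y} q → trans (sym (proj₂ (σ⁻ x))) (trans (cong σ q) (proj₂ (σ⁻ y)))) d
      ... | m , q = fold d s m , q
    ... | c , refl | c′ , refl = cong (proj₁ ∘ σ⁻) (trans (sym (proj₂ (σ⁻ c))) (trans p (proj₂ (σ⁻ c′))))

    reverse-involutive : ∀ d → reverse (reverse d) ≡ d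
    reverse-involutive (dart x y (fwd a)) = refl
    reverse-involutive (dart x y (bwd a)) = refl

    open Map (finite-dart G) σ σ-injective public
    open Edges reverse reverse-involutive public

    same-tail : ∀ {A : Dart G → Dart G → Set} x → (∀ y p → A (dart x y p) (dart x (rot x y) (closed p))) →
                ∀ {y z} (p : x ~ y) (q : x ~ z) → Star A (dart x y p) (dart x z q)
    same-tail {A} x step p q = go p q (cyclic p q)
      where
      go : ∀ {y z} (p : x ~ y) (q : x ~ z) → Star (λ u v → rot x u ≡ v) y z → Star A (dart x y p) (dart x z q)
      go p q ε rewrite ~-irrelevant G p q = ε
      go p q (refl ◅ s) = step _ p ◅ go (closed p) q s

    -- Rotation connects all darts at one vertex and reversal crosses to the other end of an edge,
    -- so paths between vertices lift to darts.
    connected⇒component : ∀ {d d′} → EqClosure _~_ (tail d) (tail d′) → Component reverse d d′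
    connected⇒component {d} {d′} = go d d′
      where
      around : ∀ {x y z} (p : x ~ y) (q : x ~ z) → Component reverse (dart x y p) (dart x z q)
      around {x} = same-tail x λ y p → fwd (inj₁ refl)
      across : ∀ {x y z} (p : x ~ y) (q : x ~ z) → Component reverse (dart x y p) (dart z x (~-sym G q))
      across p q = Eq.transitive _ (around p q) (Eq.return (inj₂ refl))
      go : ∀ d d′ → EqClosure _~_ (tail d) (tail d′) → Component reverse d d′
      go (dart x y p) (dart _ z q) ε             = around p q
      go (dart x y p) d′           (fwd s ◅ r)   = Eq.transitive _ (across p s) (go _ d′ r)
      go (dart x y p) d′           (bwd s ◅ r)   = Eq.transitive _ (across p (~-sym G s)) (go _ d′ r)

    same-edge : ∀ {d d′} → SameOrbit reverse d d′ → d ≡ d′ ⊎ reverse d ≡ d′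
    same-edge = Eq.fold (record { refl = inj₁ refl ; sym = symm ; trans = tran }) inj₂
      where
      symm : ∀ {d d′} → d ≡ d′ ⊎ reverse d ≡ d′ → d′ ≡ d ⊎ reverse d′ ≡ d
      symm (inj₁ p)    = inj₁ (sym p)
      symm (inj₂ refl) = inj₂ (reverse-involutive _)
      tran : ∀ {a b c} → a ≡ b ⊎ reverse a ≡ b → b ≡ c ⊎ reverse b ≡ c → a ≡ c ⊎ reverse a ≡ c
      tran (inj₁ refl) q           = q
      tran (inj₂ refl) (inj₁ refl) = inj₂ refl
      tran (inj₂ refl) (inj₂ refl) = inj₁ (sym (reverse-involutive _))

    -- The forward darts of two arcs share an edge only if the arcs are equal or opposite, and
    -- asymmetry excludes the latter.
    arcs≤edges : ∀ {e} → Classes (SameOrbit reverse) e → count₂ arc ≤ e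
    arcs≤edges E = count₂-≤ λ {a} {b} → injective a b
      where
      open import Data.Fin.Properties using (injective⇒≤)
      f : Arc G arc → Fin _
      f (x , y , a) = cls E (dart x y (fwd a))
      injective : ∀ a b → f a ≡ f b → a ≡ b
      injective (x , y , a) (z , w , b) p with same-edge (cls⇒ E p)
      ... | inj₁ q = arc-≡ (cong tail q) (cong head q)
        where
        arc-≡ : ∀ {x y z w a b} → x ≡ z → y ≡ w → _≡_ {A = Arc G arc} (x , y , a) (z , w , b)
        arc-≡ {x} {y} refl refl = cong (λ a → x , y , a) (T-irrelevant _ _)
      ... | inj₂ q = contradiction a (λ a → asym a (arc-flip (cong tail q) (cong head q)))
        where
        arc-flip : y ≡ z → x ≡ w → y ⟶ x
        arc-flip refl refl = b
      count₂-≤ : (∀ {a b} → f a ≡ f b → a ≡ b) → count₂ arc ≤ _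
      count₂-≤ inj = injective⇒≤ {f = f ∘ Inverse.to (fin-count₂ arc)} (↔-injective (fin-count₂ arc) ∘ inj)

    module Restrict (U : V → Bool) where

      inside : Dart G → Bool
      inside d = U (tail d) ∧ U (head d)

      inside-closed : Closed inside
      inside-closed d = ∧-comm (U (head d)) (U (tail d))

      β : Dart G → Dart G
      β = part inside

      arcIn arcOut : V → V → Bool
      arcIn  x y = arc x y ∧ (U x ∧ U y)
      arcOut x y = arc x y ∧ not (U x ∧ U y)

      arcIn+arcOut : count₂ arcIn + count₂ arcOut ≡ count₂ arc
      arcIn+arcOut = trans (sym (∑-distrib-+ (count ∘ arcIn) (count ∘ arcOut))) (sum-cong-≗ λ x →
                     trans (sym (∑-distrib-+ (⟦_⟧ ∘ arcIn x) (⟦_⟧ ∘ arcOut x))) (sum-cong-≗ λ y → bits (arc x y) (U x ∧ U y)))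
        where
        bits : ∀ a b → ⟦ a ∧ b ⟧ + ⟦ a ∧ not b ⟧ ≡ ⟦ a ⟧
        bits true  true  = refl
        bits true  false = refl
        bits false true  = refl
        bits false false = refl

      -- Only forward darts are listed, so the length is the number of deleted edges and not twice
      -- that number.
      outer : List (Dart G)
      outer = tabulate (toDart ∘ Inverse.to (fin-count₂ arcOut))
        where
        toDart : Arc G arcOut → Dart G
        toDart (x , y , t) = dart x y (fwd (true⇒T (proj₁ (∧-true (T⇒true t)))))

      ∈-outer : ∀ {x y} (a : x ⟶ y) → U x ∧ U y ≡ false → dart x y (fwd a) ∈ outer
      ∈-outer {x} {y} a eq = subst (_∈ outer) (dart-≡ G (cong proj₁ e) (cong (proj₁ ∘ proj₂) e)) (∈-tabulate⁺ (from t))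
        where
        open Inverse (fin-count₂ arcOut)
        t : Arc G arcOut
        t = x , y , true⇒T (cong₂ _∧_ (T⇒true a) (cong not eq))
        e : to (from t) ≡ t
        e = strictlyInverseˡ t

      outer-complete : ∀ d → inside d ≡ true ⊎ (d ∈ outer ⊎ reverse d ∈ outer)
      outer-complete (dart x y p) with U x ∧ U y in eq | p
      ... | true  | _     = inj₁ refl
      ... | false | fwd a = inj₂ (inj₁ (∈-outer a eq))
      ... | false | bwd a = inj₂ (inj₂ (∈-outer a (trans (∧-comm (U y) (U x)) eq)))

      -- In subtractive form f - e - 2c ≤ F - a - 2C with a = `count₂ arcIn`: restoring the deleted
      -- edges one by one never increases this quantity.
      euler-bound : ∀ {f c e F C} → Classes (SameOrbit next) f → Classes (EqClosure _~_ on tail {G}) c →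
                    Classes (SameOrbit reverse) e → Classes (Face β) F → Classes (Component β) C →
                    count₂ arcIn + (f + 2 * C) ≤ F + e + 2 * c
      euler-bound {f} {c} {e} {F} {C} f-classes c-classes e-classes F-classes C-classes = begin
        a + (f + 2 * C)                 ≤⟨ +-monoʳ-≤ a (submap inside-closed outer outer-complete F-classes C-classes f-classes (proj₂ (components reverse))) ⟩
        a + (F + length outer + 2 * c′) ≤⟨ +-monoʳ-≤ a (+-monoʳ-≤ (F + length outer) (*-monoʳ-≤ 2 (classes-antitone c-classes (proj₂ (components reverse)) connected⇒component))) ⟩
        a + (F + length outer + 2 * c)  ≡⟨ cong (λ l → a + (F + l + 2 * c)) (length-tabulate _) ⟩
        a + (F + count₂ arcOut + 2 * c) ≡⟨ lemma a F (count₂ arcOut) (2 * c) ⟩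
        F + (a + count₂ arcOut) + 2 * c ≤⟨ +-monoˡ-≤ (2 * c) (+-monoʳ-≤ F (≤-trans (≤-reflexive arcIn+arcOut) (arcs≤edges e-classes))) ⟩
        F + e + 2 * c                   ∎
        where
        open ≤-Reasoning
        a  = count₂ arcIn
        c′ = proj₁ (components reverse)
        lemma : ∀ x y z w → x + (y + z + w) ≡ y + (x + z) + w
        lemma = solve-∀

      -- Planarity enters here: the equation for the whole graph eliminates its own `f`, `e` and
      -- `c`. The remaining `v` still includes vertices outside `U`.
      restricted-euler : ∀ {v f c e F C} → v + f ≡ e + 2 * c → Classes (SameOrbit next) f → Classes (EqClosure _~_ on tail {G}) c →
                         Classes (SameOrbit reverse) e → Classes (Face β) F → Classes (Component β) C →
                         count₂ arcIn + 2 * C ≤ v + F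
      restricted-euler {v} {f} {c} {e} {F} {C} euler f-classes c-classes e-classes F-classes C-classes = +-cancelʳ-≤ f _ _ (begin
        count₂ arcIn + 2 * C + f   ≡⟨ lemma (count₂ arcIn) (2 * C) f ⟩
        count₂ arcIn + (f + 2 * C) ≤⟨ euler-bound f-classes c-classes e-classes F-classes C-classes ⟩
        F + e + 2 * c              ≡⟨ +-assoc F e (2 * c) ⟩
        F + (e + 2 * c)            ≡⟨ cong (F +_) (sym euler) ⟩
        F + (v + f)                ≡⟨ lemma′ F v f ⟩
        v + F + f                  ∎)
        where
        open ≤-Reasoning
        lemma : ∀ x y z → x + y + z ≡ x + (z + y)
        lemma = solve-∀
        lemma′ : ∀ x y z → x + (y + z) ≡ y + x + z
        lemma′ = solve-∀

      β-inside : ∀ d → inside d ≡ true → β d ≡ reverse d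
      β-inside d = part-true inside

      β-outside : ∀ d → inside d ≡ false → β d ≡ d
      β-outside d = part-false inside

      -- All of U is collapsed to one point; other vertices are isolated.
      place : Dart G → Maybe V
      place d = if U (tail d) then nothing else just (tail d)

      component⇒place : ∀ {d d′} → Component β d d′ → place d ≡ place d′
      component⇒place = Eq.fold (record { refl = refl ; sym = sym ; trans = trans }) gen
        where
        gen : ∀ {d d′} → Link β d d′ → place d ≡ place d′
        gen (inj₁ refl) = refl
        gen {d} (inj₂ refl) with U (tail d) in p | U (head d) in q
        ... | true  | true  rewrite q = refl
        ... | true  | false rewrite p = refl
        ... | false | _     rewrite p = refl

      place-out : ∀ d → U (tail d) ≡ false → place d ≡ just (tail d)
      place-out d p rewrite p = refl

      place-in : ∀ d → U (tail d) ≡ true → place d ≡ nothing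
      place-in d p rewrite p = refl

      -- Every dart at a vertex outside `U` is fixed by `β`, so the face permutation there is plain
      -- rotation.
      outside-face : ∀ {d d′} → tail d ≡ tail d′ → U (tail d) ≡ false → Face β d d′
      outside-face {dart x y p} {dart .x z q} refl out = same-tail x (λ y p → fwd (cong σ (β-outside (dart x y p) (cong (_∧ U y) out)))) p q

      module _ {v F C} (V-classes : Classes (_≡_ on tail {G}) v)
               (F-classes : Classes (Face β) F) (C-classes : Classes (Component β) C) where

        vertexIn : Fin v → Bool
        vertexIn = U ∘ tail ∘ rep V-classes

        faceIn : Fin F → Bool
        faceIn = U ∘ tail ∘ rep F-classes

        isolated : ℕ
        isolated = count (not ∘ vertexIn)

        not-true : ∀ {b} → T (not b) → b ≡ false
        not-true {false} _ = refl

        false-not : ∀ {b} → b ≡ false → T (not b)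
        false-not refl = _


        -- The invariant `place` separates the vertices outside `U` from each other and from `d`, so
        -- each of them represents a component of its own, and `d` one more.
        isolated<components : ∀ d → U (tail d) ≡ true → suc isolated ≤ C
        isolated<components d d∈U = injective⇒≤ {f = f} f-injective
          where
          open import Data.Fin.Properties using (injective⇒≤)
          open Inverse (fin-count (not ∘ vertexIn))
          at : Fin isolated → Dart G
          at = rep V-classes ∘ proj₁ ∘ to
          at-out : ∀ i → U (tail (at i)) ≡ false
          at-out i = not-true (proj₂ (to i))
          f : Fin (suc isolated) → Fin C
          f zero    = cls C-classes d
          f (suc i) = cls C-classes (at i)
          apart : ∀ i → cls C-classes d ≢ cls C-classes (at i)
          apart i p with trans (sym (place-in d d∈U)) (trans (component⇒place (cls⇒ C-classes p)) (place-out (at i) (at-out i)))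
          ... | ()
          f-injective : ∀ {i j} → f i ≡ f j → i ≡ j
          f-injective {zero}  {zero}  p = refl
          f-injective {zero}  {suc j} p = contradiction p (apart j)
          f-injective {suc i} {zero}  p = contradiction (sym p) (apart i)
          f-injective {suc i} {suc j} p = cong suc (↔-injective (fin-count (not ∘ vertexIn)) (subset-≡ (rep-injective V-classes (just-injective
            (trans (sym (place-out (at i) (at-out i))) (trans (component⇒place (cls⇒ C-classes p)) (place-out (at j) (at-out j))))))))

        -- By `outside-face`, a face based outside `U` is determined by its vertex.
        faces≤ : F ≤ count faceIn + isolated
        faces≤ = ≤-trans (≤-reflexive (sym (count-split faceIn))) (+-monoʳ-≤ (count faceIn) (count-≤ (not ∘ faceIn) f f-injective′))
          where
          g : Σ (Fin F) (T ∘ not ∘ faceIn) → Σ (Fin v) (T ∘ not ∘ vertexIn)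
          g (i , t) = cls V-classes (rep F-classes i) , false-not (trans (cong U (cls⇒ V-classes (cls-rep V-classes _))) (not-true t))
          f : Σ (Fin F) (T ∘ not ∘ faceIn) → Fin isolated
          f = Inverse.from (fin-count (not ∘ vertexIn)) ∘ g
          f-injective : ∀ x y → f x ≡ f y → proj₁ x ≡ proj₁ y
          f-injective (i , t) (j , s) p = rep-injective F-classes
            (outside-face (cls⇒ V-classes (cong proj₁ (↔-injective⁻ (fin-count (not ∘ vertexIn)) p))) (not-true t))
          f-injective′ : ∀ {x y} → f x ≡ f y → x ≡ y
          f-injective′ {i , t} {j , s} p with f-injective (i , t) (j , s) p
          ... | refl = cong (i ,_) (T-irrelevant t s)

        vertices≤ : v ≤ count U + isolated
        vertices≤ = ≤-trans (≤-reflexive (sym (count-split vertexIn))) (+-monoˡ-≤ isolated (count-≤ vertexIn f f-injective))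
          where
          f : Σ (Fin v) (T ∘ vertexIn) → Fin (count U)
          f (i , t) = Inverse.from (fin-count U) (tail (rep V-classes i) , t)
          f-injective : ∀ {x y} → f x ≡ f y → x ≡ y
          f-injective {i , t} {j , s} p with rep-injective V-classes (cong proj₁ (↔-injective⁻ (fin-count U) p))
          ... | refl = cong (i ,_) (T-irrelevant t s)

    module _ where
      open Restrict (λ _ → false)

      -- Restriction to the empty set dissolves every edge, which leaves at most `v` faces and at
      -- least `v` components. The resulting inequality holds for every rotation system and is one
      -- half of the planarity proof for the witness graph.
      genus : ∀ {v e f c} → Classes (_≡_ on tail {G}) v → Classes (SameOrbit reverse) e →
              Classes (SameOrbit next) f → Classes (EqClosure _~_ on tail {G}) c → v + f ≤ e + 2 * c
      genus {v} {e} {f} {c} V E F C = bound (proj₂ (faces β)) (proj₂ (components β))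
        where
        open ≤-Reasoning
        lemma : ∀ x y → x + (x + y) ≡ y + 2 * x
        lemma = solve-∀
        bound : ∀ {f₀ c₀} → Classes (Face β) f₀ → Classes (Component β) c₀ → v + f ≤ e + 2 * c
        bound {f₀} {c₀} F₀ C₀ = +-cancelˡ-≤ v _ _ (begin
          v + (v + f)                        ≡⟨ lemma v f ⟩
          f + 2 * v                          ≤⟨ +-monoʳ-≤ f (*-monoʳ-≤ 2 (classes-antitone C₀ V (just-injective ∘ component⇒place))) ⟩
          f + 2 * c₀                         ≤⟨ m≤n+m _ (count₂ arcIn) ⟩
          count₂ arcIn + (f + 2 * c₀)        ≤⟨ euler-bound F C E F₀ C₀ ⟩
          f₀ + e + 2 * c                     ≡⟨ +-assoc f₀ e (2 * c) ⟩
          f₀ + (e + 2 * c)                   ≤⟨ +-monoˡ-≤ (e + 2 * c) (classes-antitone V F₀ (λ p → outside-face p refl)) ⟩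
          v + (e + 2 * c)                    ∎)

-- Long threads in planar graphs of large girth and minimum degree 2.

module Sparse where

  open import Defs hiding (_≤_)
  open Counting
  open Maps
  open Surfaces
  open import Data.Bool.Base using (Bool; true; false; _∧_; _∨_; not; T)
  import Data.Bool.Properties as Bool
  open import Data.Fin.Base using (Fin; zero; suc; toℕ; fromℕ<; remQuot)
  open import Data.Fin.Properties using (_≟_; any?; all?; ¬∀⟶∃¬; toℕ-injective; toℕ-inject₁; toℕ-fromℕ; toℕ-fromℕ<; toℕ<n; *↔×)
  open import Data.Nat.Base as ℕ using (ℕ; zero; suc; _+_; _*_; _≤_; _<_; z≤n; s≤s; z<s; s<s)
  open import Data.Nat.GeneralisedArithmetic using (fold)
  open import Data.Nat.Properties hiding (_≟_)
  open import Data.Nat.Induction using (<-rec)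
  open import Data.Nat.Tactic.RingSolver using (solve-∀)
  open import Data.Product.Base using (Σ; ∃; _×_; _,_; proj₁; proj₂)
  open import Data.Sum.Base using (_⊎_; inj₁; inj₂)
  open import Function.Base using (_∘_; _on_)
  open import Function.Bundles using (Inverse)
  open import Relation.Binary.Definitions using (tri<; tri≈; tri>)
  open import Relation.Binary.PropositionalEquality
  import Relation.Binary.Construct.Closure.Equivalence as Eq
  open import Relation.Binary.Construct.Closure.ReflexiveTransitive using (Star; ε; _◅_)
  open import Relation.Binary.Construct.Closure.Symmetric using (fwd; bwd)
  open import Relation.Nullary using (¬_; Dec; yes; no; contradiction)
  open import Relation.Nullary.Decidable using (_×-dec_)

  module _ (G : OrientedGraph) where
    open OrientedGraph G

    record Walk (w : ℕ → V) : Set where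
      field
        adjacent : ∀ i → w i ~ w (suc i)
        turn     : ∀ i → w i ≢ w (2 + i)

    -- With no shorter return anywhere, the vertices before the return are distinct; looplessness
    -- and `turn` rule out lengths 1 and 2.
    closed-walk⇒cycle : ∀ {w} → Walk w → ∀ i m → w i ≡ w (i + suc m) →
                        (∀ {j ℓ} → 0 < ℓ → ℓ < suc m → w j ≢ w (j + ℓ)) → Cycle G m
    closed-walk⇒cycle {w} W i m back distinct = record
      { length≥3  = long m back
      ; vertex    = λ j → w (i + toℕ j)
      ; injective = λ {j} {j′} → inj j j′
      ; step      = λ j → subst₂ _~_ (cong (λ k → w (i + k)) (sym (toℕ-inject₁ j))) (cong w (sym (+-suc i (toℕ j)))) (adjacent (i + toℕ j))
      ; closing   = subst₂ _~_ (cong (λ k → w (i + k)) (sym (toℕ-fromℕ m))) (trans (cong w (sym (+-suc i m))) (trans (sym back) (cong w (sym (+-identityʳ i))))) (adjacent (i + m))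
      }
      where
      open Walk W
      long : ∀ m → w i ≡ w (i + suc m) → 3 ≤ suc m
      long zero          p = contradiction (subst (w i ~_) (trans (cong w (sym (+-comm i 1))) (sym p)) (adjacent i)) (loopless G)
      long (suc zero)    p = contradiction (trans p (cong w (+-comm i 2))) (turn i)
      long (suc (suc m)) p = s≤s (s≤s (s≤s z≤n))
      apart : ∀ {a b} → a < b → b < suc m → w (i + a) ≢ w (i + b)
      apart {a} {b} a<b b<m p = distinct (m<n⇒0<n∸m a<b) (≤-<-trans (m∸n≤m b a) b<m)
        (trans p (cong w (trans (cong (i +_) (sym (m+[n∸m]≡n (<⇒≤ a<b)))) (sym (+-assoc i a _)))))
      inj : ∀ (j j′ : Fin (suc m)) → w (i + toℕ j) ≡ w (i + toℕ j′) → j ≡ j′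
      inj j j′ p with <-cmp (toℕ j) (toℕ j′)
      ... | tri< l _ _ = contradiction p (apart l (toℕ<n j′))
      ... | tri≈ _ e _ = toℕ-injective e
      ... | tri> _ _ l = contradiction (sym p) (apart l (toℕ<n j))

    -- Strong induction on `ℓ` for all starting points at once: if there is no shorter return, a
    -- return after `ℓ` steps is a cycle shorter than the girth allows.
    walk-distinct : ∀ {g w} → Girth≥ g G → Walk w → ∀ ℓ → 0 < ℓ → ℓ < g → ∀ {i} → w i ≢ w (i + ℓ)
    walk-distinct {g} {w} girth W = <-rec _ λ where
      (suc m) ih _ ℓ<g {i} p → <⇒≱ ℓ<g (girth (closed-walk⇒cycle W i m p λ 0<ℓ ℓ<m → ih ℓ<m 0<ℓ (<-trans ℓ<m ℓ<g)))

    module Induced (U : V → Bool) where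

      neighbour : V → V → Bool
      neighbour x y = (U x ∧ U y) ∧ (arc x y ∨ arc y x)

      degree : V → ℕ
      degree x = count (neighbour x)

      adjacent⇒ : ∀ {x y} → x ~ y → arc x y ∨ arc y x ≡ true
      adjacent⇒ {x} {y} (fwd a) rewrite T⇒true a = refl
      adjacent⇒ {x} {y} (bwd a) rewrite T⇒true a = Bool.∨-zeroʳ (arc x y)

      adjacent⇐ : ∀ {x y} → arc x y ∨ arc y x ≡ true → x ~ y
      adjacent⇐ {x} {y} p with arc x y in eq
      ... | true  = fwd (true⇒T eq)
      ... | false = bwd (true⇒T p)

      neighbour⇒ : ∀ {x y} → U x ≡ true → U y ≡ true → x ~ y → T (neighbour x y)
      neighbour⇒ p q a = true⇒T (cong₂ _∧_ (cong₂ _∧_ p q) (adjacent⇒ a))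

      neighbour⇐ : ∀ {x y} → T (neighbour x y) → U x ≡ true × U y ≡ true × x ~ y
      neighbour⇐ t with ∧-true (T⇒true t)
      ... | p , q with ∧-true p
      ...   | u , v = u , v , adjacent⇐ q

      -- The path is the initial segment vertex 0, ..., vertex (1 + M) of the walk.
      record Thread (M : ℕ) : Set where
        field
          vertex : ℕ → V
          walk   : Walk vertex
          inU    : ∀ i → U (vertex i) ≡ true
          thin   : ∀ i → i < M → degree (vertex (suc i)) ≤ 2

      two-neighbours : ∀ {y} → 2 ≤ degree y → ∃ λ a → ∃ λ b → T (neighbour y a) × T (neighbour y b) × a ≢ b
      two-neighbours {y} 2≤d = _ , _ , proj₂ (to i) , proj₂ (to j) , λ p → i≢j (↔-injective (fin-count (neighbour y)) (subset-≡ p))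
        where
        open Inverse (fin-count (neighbour y))
        0<d = <⇒≤ 2≤d
        i = fromℕ< 0<d
        j = fromℕ< 2≤d
        i≢j : i ≢ j
        i≢j p with trans (sym (toℕ-fromℕ< 0<d)) (trans (cong toℕ p) (toℕ-fromℕ< 2≤d))
        ... | ()

      other : ∀ {y} → 2 ≤ degree y → ∀ x → ∃ λ z → T (neighbour y z) × z ≢ x
      other 2≤d x with two-neighbours 2≤d
      ... | a , b , ta , tb , a≢b with a ≟ x
      ...   | no a≢x   = a , ta , a≢x
      ...   | yes refl = b , tb , a≢b ∘ sym

      degree≥2 : ∀ {y a b} → T (neighbour y a) → T (neighbour y b) → a ≢ b → 2 ≤ degree y
      degree≥2 {y} {a} {b} ta tb a≢b = ≤-count (neighbour y) f (λ {i} {j} → inj i j)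
        where
        f : Fin 2 → Σ V (T ∘ neighbour y)
        f zero    = a , ta
        f (suc _) = b , tb
        inj : ∀ i j → f i ≡ f j → i ≡ j
        inj zero zero _ = refl
        inj zero (suc zero) p = contradiction (cong proj₁ p) a≢b
        inj (suc zero) zero p = contradiction (cong proj₁ (sym p)) a≢b
        inj (suc zero) (suc zero) _ = refl

      degree≥3 : ∀ {y a b c} → T (neighbour y a) → T (neighbour y b) → T (neighbour y c) →
                 a ≢ b → a ≢ c → b ≢ c → 3 ≤ degree y
      degree≥3 {y} {a} {b} {c} ta tb tc a≢b a≢c b≢c = ≤-count (neighbour y) f (λ {i} {j} → inj i j)
        where
        f : Fin 3 → Σ V (T ∘ neighbour y)
        f zero             = a , ta
        f (suc zero)       = b , tb
        f (suc (suc zero)) = c , tc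
        inj : ∀ i j → f i ≡ f j → i ≡ j
        inj zero             zero             _ = refl
        inj zero             (suc zero)       p = contradiction (cong proj₁ p) a≢b
        inj zero             (suc (suc zero)) p = contradiction (cong proj₁ p) a≢c
        inj (suc zero)       zero             p = contradiction (cong proj₁ (sym p)) a≢b
        inj (suc zero)       (suc zero)       _ = refl
        inj (suc zero)       (suc (suc zero)) p = contradiction (cong proj₁ p) b≢c
        inj (suc (suc zero)) zero             p = contradiction (cong proj₁ (sym p)) a≢c
        inj (suc (suc zero)) (suc zero)       p = contradiction (cong proj₁ (sym p)) b≢c
        inj (suc (suc zero)) (suc (suc zero)) _ = refl

      module Rotation (R : RotationSystem G) where
        open RotationSystem R
        open Surface G R
        open Restrict U
        open Dart

        handshake : sum degree ≡ 2 * count₂ arcIn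
        handshake = begin
          sum degree                                               ≡⟨ sum-cong-≗ (λ x → trans (sum-cong-≗ (bits x)) (∑-distrib-+ (⟦_⟧ ∘ arcIn x) (λ y → ⟦ arcIn y x ⟧))) ⟩
          sum (λ x → count (arcIn x) + count (λ y → arcIn y x))    ≡⟨ ∑-distrib-+ (count ∘ arcIn) (λ x → count (λ y → arcIn y x)) ⟩
          count₂ arcIn + sum (λ x → count (λ y → arcIn y x))       ≡⟨ cong (count₂ arcIn +_) (∑-comm (λ x y → ⟦ arcIn y x ⟧)) ⟩
          count₂ arcIn + count₂ arcIn                              ≡⟨ cong (count₂ arcIn +_) (sym (+-identityʳ _)) ⟩
          2 * count₂ arcIn                                         ∎
          where
          open ≡-Reasoning
          bits : ∀ x y → ⟦ neighbour x y ⟧ ≡ ⟦ arcIn x y ⟧ + ⟦ arcIn y x ⟧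
          bits x y with U x | U y | arc x y in p | arc y x in q
          ... | true  | true  | true  | true  = contradiction (true⇒T q) (asym (true⇒T p))
          ... | true  | true  | true  | false = refl
          ... | true  | true  | false | true  = refl
          ... | true  | true  | false | false = refl
          ... | true  | false | true  | true  = refl
          ... | true  | false | true  | false = refl
          ... | true  | false | false | true  = refl
          ... | true  | false | false | false = refl
          ... | false | true  | true  | true  = refl
          ... | false | true  | true  | false = refl
          ... | false | true  | false | true  = refl
          ... | false | true  | false | false = refl
          ... | false | false | true  | true  = refl
          ... | false | false | true  | false = refl
          ... | false | false | false | true  = refl
          ... | false | false | false | false = refl

        Inner : Dart G → Set
        Inner d = U (tail d) ≡ true × U (head d) ≡ true

        inner⇒inside : ∀ {d} → Inner d → inside d ≡ true
        inner⇒inside (p , q) = cong₂ _∧_ p q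

        -- Rotate around y until an inner dart not pointing to x is met. Passing
        -- over x itself does no harm, since its successor lies on the face of d.
        seek : ∀ {d x y w z} (q : y ~ w) → U y ≡ true → (∀ (p : y ~ x) → Face β d (σ (dart y x p))) →
               Face β d (σ (dart y w q)) → w ≡ x ⊎ U w ≡ false → z ≢ x → U z ≡ true →
               Star (λ u v → rot y u ≡ v) w z → ∃ λ d′ → Inner d′ × tail d′ ≡ y × head d′ ≢ x × Face β d d′
        seek q _ _ _ (inj₁ refl) z≢x _ ε = contradiction refl z≢x
        seek q _ _ _ (inj₂ out) _ z∈U ε = contradiction (trans (sym z∈U) out) λ ()
        seek {d} {x} {y} {w} q y∈U skip r _ z≢x z∈U (refl ◅ s) with rot y w ≟ x | U (rot y w) in eq
        ... | yes p | _     = seek (closed q) y∈U skip (subst (Face β d) (cong σ (dart-≡ G refl (sym p))) (skip (subst (y ~_) p (closed q)))) (inj₁ p) z≢x z∈U s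
        ... | no ne | true  = dart y (rot y w) (closed q) , (y∈U , eq) , refl , ne , r
        ... | no ne | false = seek (closed q) y∈U skip (Eq.transitive _ r (Eq.return (cong σ (β-outside _ out)))) (inj₂ eq) z≢x z∈U s
          where
          out : U y ∧ U (rot y w) ≡ false
          out rewrite eq = Bool.∧-zeroʳ (U y)

        module MinDegree (min : ∀ x → U x ≡ true → 2 ≤ degree x) where

          -- Minimum degree 2 supplies a neighbour `z` in `U` other than `x`, at which the search
          -- along the face stops at the latest.
          onward : ∀ d → Inner d → ∃ λ d′ → Inner d′ × tail d′ ≡ head d × head d′ ≢ tail d × Face β d d′
          onward (dart x y p) (x∈U , y∈U) with other (min y y∈U) x
          ... | z , t , z≢x with neighbour⇐ t
          ...   | _ , z∈U , y~z = seek p⁻ y∈U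
                    (λ p′ → subst (Face β _) (cong (λ q → σ (dart y x q)) (~-irrelevant G p⁻ p′)) first) first (inj₁ refl) z≢x z∈U (cyclic p⁻ y~z)
            where
            p⁻ = ~-sym G p
            first : Face β (dart x y p) (σ (dart y x p⁻))
            first = Eq.return (cong σ (β-inside (dart x y p) (inner⇒inside {dart x y p} (x∈U , y∈U))))

          enter-outside : ∀ {y w} (q : y ~ w) → U y ≡ true → U w ≡ false → ∃ λ d′ → Inner d′ × Face β (dart y w q) d′
          enter-outside {y} {w} q y∈U w∉U with other (min y y∈U) y
          -- The vertex to avoid is taken to be `y` itself, which is no neighbour of `y`, so the
          -- condition on passing over it is vacuous.
          ... | z , t , z≢y = forget (seek {d = d} q y∈U (λ p → contradiction p (loopless G)) first (inj₂ w∉U) z≢y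
                                        (proj₁ (proj₂ (neighbour⇐ t))) (cyclic q (proj₂ (proj₂ (neighbour⇐ t)))))
            where
            d = dart y w q
            first : Face β d (σ d)
            first = Eq.return (cong σ (β-outside d (trans (cong (U y ∧_) w∉U) (Bool.∧-zeroʳ (U y)))))
            forget : (∃ λ d′ → Inner d′ × tail d′ ≡ y × head d′ ≢ y × Face β d d′) → ∃ λ d′ → Inner d′ × Face β d d′
            forget (d′ , inner , _ , _ , r) = d′ , inner , r

          enter : ∀ d → U (tail d) ≡ true → ∃ λ d′ → Inner d′ × Face β d d′
          enter d y∈U with U (head d) Bool.≟ true
          ... | yes w∈U = d , (y∈U , w∈U) , Eq.reflexive _
          ... | no w∉U  = enter-outside (adjacent d) y∈U (Bool.¬-not w∉U)

          inner? : ∀ d → Dec (Inner d)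
          inner? d = (U (tail d) Bool.≟ true) ×-dec (U (head d) Bool.≟ true)

          next′ : Dart G → Dart G
          next′ d with inner? d
          ... | yes i = proj₁ (onward d i)
          ... | no  _ = d

          next′-spec : ∀ d → Inner d → Inner (next′ d) × tail (next′ d) ≡ head d × head (next′ d) ≢ tail d × Face β d (next′ d)
          next′-spec d i with inner? d
          ... | yes i = proj₂ (onward d i)
          ... | no ¬i = contradiction i ¬i

          iter : Dart G → ℕ → Dart G
          iter d n = fold d next′ n

          iter-inner : ∀ {d} → Inner d → ∀ n → Inner (iter d n)
          iter-inner i zero    = i
          iter-inner i (suc n) = proj₁ (next′-spec _ (iter-inner i n))

          iter-face : ∀ {d} → Inner d → ∀ n → Face β d (iter d n)
          iter-face i zero    = Eq.reflexive _
          iter-face i (suc n) = Eq.transitive _ (iter-face i n) (proj₂ (proj₂ (proj₂ (next′-spec _ (iter-inner i n)))))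

          iter-tail : ∀ {d} → Inner d → ∀ n → tail (iter d (suc n)) ≡ head (iter d n)
          iter-tail i n = proj₁ (proj₂ (next′-spec _ (iter-inner i n)))

          iter-walk : ∀ {d} → Inner d → Walk (tail ∘ iter d)
          iter-walk {d} i = record
            { adjacent = λ n → subst (tail (iter d n) ~_) (sym (iter-tail i n)) (adjacent (iter d n))
            ; turn     = λ n p → proj₁ (proj₂ (proj₂ (next′-spec _ (iter-inner i n)))) (sym (trans p (iter-tail i (suc n))))
            }

          iter-+ : ∀ d m n → iter d (m + n) ≡ iter (iter d n) m
          iter-+ d zero    n = refl
          iter-+ d (suc m) n = cong next′ (iter-+ d m n)

          -- The assumption `branch`, to be refuted by counting, says that every walk along a face
          -- meets a vertex of degree at least 3 within any `M` consecutive steps.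
          module _ {g M : ℕ} (6M≤g : 6 * M ≤ g) (girth : Girth≥ g G) (spherical : Spherical)
                   (branch : ∀ d → Inner d → ∃ λ i → i < M × 3 ≤ degree (tail (iter d (suc i)))) where

            hop : Dart G → ℕ
            hop d with inner? d
            ... | yes i = suc (proj₁ (branch d i))
            ... | no  _ = 0

            hop-spec : ∀ d → Inner d → 0 < hop d × hop d ≤ M × 3 ≤ degree (tail (iter d (hop d)))
            hop-spec d i with inner? d
            ... | no ¬i = contradiction i ¬i
            ... | yes i with branch d i
            ...   | _ , j<M , big = z<s , j<M , big

            -- Positions of successive vertices of degree at least 3 chosen by `branch`. Index 0 is
            -- only the starting point, so the stops proper begin at index 1.
            stop : Dart G → ℕ → ℕ
            stop d zero    = 0
            stop d (suc j) = hop (iter d (stop d j)) + stop d j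

            module _ (d : Dart G) (i : Inner d) where

              stop-≤ : ∀ j → stop d j ≤ j * M
              stop-≤ zero    = z≤n
              stop-≤ (suc j) = +-mono-≤ (proj₁ (proj₂ (hop-spec _ (iter-inner i (stop d j))))) (stop-≤ j)

              stop-< : ∀ {j k} → j < k → stop d j < stop d k
              stop-< {j} {suc k} (s≤s j≤k) with m≤n⇒m<n∨m≡n j≤k
              ... | inj₁ j<k  = <-≤-trans (stop-< j<k) (m≤n+m _ _)
              ... | inj₂ refl = m<n+m (stop d j) (proj₁ (hop-spec _ (iter-inner i (stop d j))))

              stop-big : ∀ j → 3 ≤ degree (tail (iter d (stop d (suc j))))
              stop-big j = subst (λ e → 3 ≤ degree (tail e)) (sym (iter-+ d (hop _) (stop d j)))
                             (proj₂ (proj₂ (hop-spec _ (iter-inner i (stop d j)))))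

              stop-distinct : ∀ {j k} → j < k → k < 6 → tail (iter d (stop d (suc j))) ≢ tail (iter d (stop d (suc k)))
              stop-distinct {j} {k} j<k k<6 p = walk-distinct girth (iter-walk {d} i) (b ℕ.∸ a) (m<n⇒0<n∸m a<b)
                -- As `a` is positive, the gap `b ∸ a` is strictly smaller than `b`, and
                -- `b ≤ 6 * M ≤ g`.
                (<-≤-trans (∸-monoʳ-< (stop-< (s≤s (z≤n {j}))) (<⇒≤ a<b)) (≤-trans (stop-≤ (suc k)) (≤-trans (*-monoˡ-≤ M k<6) 6M≤g))) {a}
                (trans p (cong (tail ∘ iter d) (sym (m+[n∸m]≡n (<⇒≤ a<b)))))
                where
                a = stop d (suc j)
                b = stop d (suc k)
                a<b : a < b
                a<b = stop-< (s<s j<k)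

            branching : V → Bool
            branching x = 3 ℕ.≤ᵇ degree x

            branchDart : V → V → Bool
            branchDart x y = branching x ∧ neighbour x y

            open Spherical spherical

            module _ {F C} (F-classes : Classes (Face β) F) (C-classes : Classes (Component β) C) where

              facesIn : ℕ
              facesIn = count (faceIn vertices F-classes C-classes)

              -- A corner at a stop is recorded by its outgoing dart. The dart determines the face,
              -- and on one face the first six stops have distinct tails.
              six-per-face : 6 * facesIn ≤ count₂ branchDart
              six-per-face = ≤-count₂ branchDart (pair ∘ remQuot facesIn) λ {k} {l} p →
                  ↔-injective *↔× (injective (remQuot {6} facesIn k) (remQuot {6} facesIn l) p)
                where
                open Inverse (fin-count (faceIn vertices F-classes C-classes))
                start : Fin facesIn → Dart G
                start j = rep F-classes (proj₁ (to j))
                entry : ∀ j → ∃ λ d → Inner d × Face β (start j) d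
                entry j = enter (start j) (T⇒true (proj₂ (to j)))
                at : Fin 6 × Fin facesIn → Dart G
                at (i , j) = iter (proj₁ (entry j)) (stop (proj₁ (entry j)) (suc (toℕ i)))
                at-inner : ∀ k → Inner (at k)
                at-inner (i , j) = iter-inner (proj₁ (proj₂ (entry j))) (stop (proj₁ (entry j)) (suc (toℕ i)))
                at-big : ∀ k → 3 ≤ degree (tail (at k))
                at-big (i , j) = stop-big _ (proj₁ (proj₂ (entry j))) (toℕ i)
                at-face : ∀ k → Face β (start (proj₂ k)) (at k)
                at-face (i , j) = Eq.transitive _ (proj₂ (proj₂ (entry j))) (iter-face (proj₁ (proj₂ (entry j))) (stop (proj₁ (entry j)) (suc (toℕ i))))
                pair : Fin 6 × Fin facesIn → Σ V λ x → Σ V λ y → T (branchDart x y)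
                pair k = tail (at k) , head (at k) , true⇒T (cong₂ _∧_ (T⇒true (≤⇒≤ᵇ (at-big k)))
                           (T⇒true (neighbour⇒ (proj₁ (at-inner k)) (proj₂ (at-inner k)) (adjacent (at k)))))
                face-agrees : ∀ k l → at k ≡ at l → proj₂ k ≡ proj₂ l
                face-agrees k l p = ↔-injective (fin-count (faceIn vertices F-classes C-classes)) (subset-≡ (rep-injective F-classes
                  (Eq.transitive _ (at-face k) (Eq.transitive _ (subst (Face β (at k)) p (Eq.reflexive _)) (Eq.symmetric _ (at-face l))))))
                same-index : ∀ i i′ j → tail (at (i , j)) ≡ tail (at (i′ , j)) → i ≡ i′
                same-index i i′ j p with <-cmp (toℕ i) (toℕ i′)
                ... | tri< l _ _ = contradiction p (stop-distinct _ (proj₁ (proj₂ (entry j))) l (toℕ<n i′))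
                ... | tri≈ _ e _ = toℕ-injective e
                ... | tri> _ _ l = contradiction (sym p) (stop-distinct _ (proj₁ (proj₂ (entry j))) l (toℕ<n i))
                injective : ∀ k l → pair k ≡ pair l → k ≡ l
                injective (i , j) (i′ , j′) p with face-agrees (i , j) (i′ , j′) (dart-≡ G (cong proj₁ p) (cong (proj₁ ∘ proj₂) p))
                ... | refl = cong (_, j) (same-index i i′ j (cong proj₁ p))

              -- Vertex by vertex, with d the degree: 6 ≤ 3d when d is at least 2, and 6 + d ≤ 3d
              -- when d is at least 3. This is why six corners per face are wanted.
              charge : 6 * count U + count₂ branchDart ≤ 3 * sum degree
              charge = begin
                6 * count U + count₂ branchDart                     ≡⟨ cong (_+ count₂ branchDart) (*-sum 6 (⟦_⟧ ∘ U)) ⟩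
                sum (λ x → 6 * ⟦ U x ⟧) + count₂ branchDart         ≡⟨ sym (∑-distrib-+ (λ x → 6 * ⟦ U x ⟧) (count ∘ branchDart)) ⟩
                sum (λ x → 6 * ⟦ U x ⟧ + count (branchDart x))      ≤⟨ sum-mono local ⟩
                sum (λ x → 3 * degree x)                            ≡⟨ sym (*-sum 3 degree) ⟩
                3 * sum degree                                      ∎
                where
                open ≤-Reasoning
                *-sum : ∀ k {n} (f : Fin n → ℕ) → k * sum f ≡ sum (λ i → k * f i)
                *-sum k {zero}  f = *-zeroʳ k
                *-sum k {suc n} f = trans (*-distribˡ-+ k (f zero) _) (cong (k * f zero +_) (*-sum k (f ∘ suc)))
                sum-mono : ∀ {n} {f g : Fin n → ℕ} → (∀ i → f i ≤ g i) → sum f ≤ sum g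
                sum-mono {zero}  le = z≤n
                sum-mono {suc n} le = +-mono-≤ (le zero) (sum-mono (le ∘ suc))
                count-∧ : ∀ b {n} (P : Fin n → Bool) → count (λ i → b ∧ P i) ≤ ⟦ b ⟧ * count P
                count-∧ true  P = ≤-reflexive (sym (+-identityʳ _))
                count-∧ false {zero}  P = z≤n
                count-∧ false {suc n} P = count-∧ false (P ∘ suc)
                weight : ∀ u d b → (u ≡ true → 2 ≤ d) → (T b → 3 ≤ d) → 6 * ⟦ u ⟧ + ⟦ b ⟧ * d ≤ 3 * d
                weight true  d false two _ = ≤-trans (*-monoʳ-≤ 3 (two refl)) ≤-refl
                weight true  d true  _ three = ≤-trans (+-mono-≤ (*-monoʳ-≤ 2 (three _)) (≤-reflexive (+-identityʳ d))) (≤-reflexive (lemma d))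
                  where
                  lemma : ∀ d → 2 * d + d ≡ 3 * d
                  lemma = solve-∀
                weight false d false _ _ = z≤n
                weight false d true  _ _ = *-monoˡ-≤ d (s≤s (z≤n {2}))
                local : ∀ x → 6 * ⟦ U x ⟧ + count (branchDart x) ≤ 3 * degree x
                local x = ≤-trans (+-monoʳ-≤ (6 * ⟦ U x ⟧) (count-∧ (branching x) (neighbour x)))
                            (weight (U x) (degree x) (branching x) (min x) (≤ᵇ⇒≤ 3 (degree x)))

              overfull : ¬ (suc (isolated vertices F-classes C-classes) ≤ C)
              -- The 12 is six times the 2 that Euler's formula grants to one component; the
              -- isolated vertices contribute `12 * i` on both sides.
              overfull iso<C = <⇒≱ (m<n+m _ {12} z<s) (begin
                12 + (6 * a + 12 * i)                            ≡⟨ lemma₁ a i ⟩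
                6 * (a + 2 * suc i)                              ≤⟨ *-monoʳ-≤ 6 (+-monoʳ-≤ a (*-monoʳ-≤ 2 iso<C)) ⟩
                6 * (a + 2 * C)                                  ≤⟨ *-monoʳ-≤ 6 (restricted-euler euler faces′ components′ edges F-classes C-classes) ⟩
                6 * (v + F)                                      ≤⟨ *-monoʳ-≤ 6 (+-mono-≤ (vertices≤ vertices F-classes C-classes) (faces≤ vertices F-classes C-classes)) ⟩
                6 * ((u + i) + (facesIn + i))                    ≡⟨ lemma₂ u facesIn i ⟩
                6 * u + 6 * facesIn + 12 * i                     ≤⟨ +-monoˡ-≤ (12 * i) (+-monoʳ-≤ (6 * u) six-per-face) ⟩
                6 * u + count₂ branchDart + 12 * i               ≤⟨ +-monoˡ-≤ (12 * i) charge ⟩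
                3 * sum degree + 12 * i                          ≡⟨ cong (λ s → 3 * s + 12 * i) handshake ⟩
                3 * (2 * a) + 12 * i                             ≡⟨ lemma₃ a i ⟩
                6 * a + 12 * i                                   ∎)
                where
                open ≤-Reasoning
                a = count₂ arcIn
                i = isolated vertices F-classes C-classes
                u = count U
                faces′ = Spherical.faces spherical
                components′ = Spherical.components spherical
                lemma₁ : ∀ a i → 12 + (6 * a + 12 * i) ≡ 6 * (a + 2 * suc i)
                lemma₁ = solve-∀
                lemma₂ : ∀ u f i → 6 * ((u + i) + (f + i)) ≡ 6 * u + 6 * f + 12 * i
                lemma₂ = solve-∀
                lemma₃ : ∀ a i → 3 * (2 * a) + 12 * i ≡ 6 * a + 12 * i
                lemma₃ = solve-∀

              impossible : ∀ {x₀} → ¬ (U x₀ ≡ true)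
              impossible {x₀} x₀∈U with other (min x₀ x₀∈U) x₀
              ... | y , t , _ = overfull (isolated<components vertices F-classes C-classes
                                  (dart x₀ y (proj₂ (proj₂ (neighbour⇐ t)))) x₀∈U)

        -- Darts are finite in number, so it is decidable whether one of them starts a run of `M`
        -- vertices of degree at most 2. If none does, the counting argument applies.
        thread-exists : ∀ {g M x₀} → 6 * M ≤ g → Girth≥ g G → Spherical → (∀ x → U x ≡ true → 2 ≤ degree x) → U x₀ ≡ true → Thread M
        thread-exists {g} {M} {x₀} 6M≤g girth spherical min x₀∈U with any? thin?
          where
          open MinDegree min
          open Inverse (proj₂ (finite-dart G))
          Thin : Dart G → Set
          Thin d = Inner d × (∀ (i : Fin M) → degree (tail (iter d (suc (toℕ i)))) ≤ 2)
          thin? : ∀ k → Dec (Thin (from k))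
          thin? k = inner? (from k) ×-dec all? λ i → degree (tail (iter (from k) (suc (toℕ i)))) ≤? 2
        ... | yes (k , i , thin) = record
          { vertex = tail ∘ iter (from k)
          ; walk   = iter-walk i
          ; inU    = proj₁ ∘ iter-inner i
          ; thin   = λ j j<M → subst (λ j → degree (tail (iter (from k) (suc j))) ≤ 2) (toℕ-fromℕ< j<M) (thin (fromℕ< j<M))
          }
          where
          open MinDegree min
          open Inverse (proj₂ (finite-dart G))
        ... | no none = contradiction x₀∈U (impossible 6M≤g girth spherical branch (proj₂ (Surface.faces G R β)) (proj₂ (Surface.components G R β)))
          where
          open MinDegree min
          open Inverse (proj₂ (finite-dart G))
          branch : ∀ d → Inner d → ∃ λ i → i < M × 3 ≤ degree (tail (iter d (suc i)))
          branch d inner with all? {n = M} (λ i → degree (tail (iter d (suc (toℕ i)))) ≤? 2)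
          ... | yes thin = contradiction (to d , subst (λ d → Inner d × (∀ (i : Fin M) → degree (tail (iter d (suc (toℕ i)))) ≤ 2)) (sym (strictlyInverseʳ d)) (inner , thin)) none
          ... | no ¬thin with ¬∀⟶∃¬ M _ (λ i → degree (tail (iter d (suc (toℕ i)))) ≤? 2) ¬thin
          ...   | i , big = toℕ i , toℕ<n i , ≰⇒> big

-- Homomorphisms into the circulant digraph on ℤ/(4b+1).

module Extend where

  open import Defs hiding (_≤_)
  open Counting
  open Surfaces
  open Sparse
  open import Data.Bool.Base using (Bool; true; false; _∧_; not; T; if_then_else_)
  open import Data.Bool.Properties using (T?)
  import Data.Bool.Properties as Bool
  open import Data.Fin.Base using (Fin; zero; suc; toℕ; fromℕ<)
  open import Data.Fin.Properties using (_≟_; any?; toℕ-fromℕ<; toℕ<n)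
  open import Data.Nat.Base as ℕ using (ℕ; zero; suc; _+_; _*_; _∸_; _≤_; _<_; s≤s; z<s; s≤s⁻¹)
  open import Data.Nat.DivMod
  open import Data.Nat.Properties hiding (_≟_)
  open import Data.Nat.Tactic.RingSolver using (solve-∀)
  open import Data.Product.Base using (Σ; ∃; _×_; _,_; proj₁; proj₂; swap)
  open import Data.Sum.Base using (_⊎_; inj₁; inj₂)
  open import Function.Base using (_∘_)
  open import Function.Bundles using (Inverse)
  open import Relation.Binary.Definitions using (tri<; tri≈; tri>)
  open import Relation.Binary.PropositionalEquality
  open import Relation.Binary.Construct.Closure.Symmetric using (fwd)
  open import Relation.Nullary using (¬_; Dec; yes; no; does; contradiction)
  open import Relation.Nullary.Decidable using (dec-true; dec-false)

  count-< : ∀ {n} {P Q : Fin n → Bool} {x} → (∀ {y} → T (P y) → T (Q y)) → T (Q x) → ¬ T (P x) → count P < count Q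
  count-< {P = P} {Q} {x} P⊆Q Qx ¬Px = ≤-count Q f λ {i} {j} → injective i j
    where
    open Inverse (fin-count P)
    f : Fin (suc (count P)) → Σ _ (T ∘ Q)
    f zero    = x , Qx
    f (suc i) = proj₁ (to i) , P⊆Q (proj₂ (to i))
    hit : ∀ {y} i → y ≡ proj₁ (to i) → T (P y)
    hit i p = subst (T ∘ P) (sym p) (proj₂ (to i))
    injective : ∀ i j → f i ≡ f j → i ≡ j
    injective zero    zero    p = refl
    injective zero    (suc j) p = contradiction (hit j (cong proj₁ p)) ¬Px
    injective (suc i) zero    p = contradiction (hit i (cong proj₁ (sym p))) ¬Px
    injective (suc i) (suc j) p = cong suc (↔-injective (fin-count P) (subset-≡ (cong proj₁ p)))

  does-true : ∀ {A : Set} (a? : Dec A) → does a? ≡ true → A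
  does-true (yes a) _ = a

  ⊓-suc : ∀ {i j} (d : Dec (i < j)) → i ℕ.⊓ j + ⟦ does d ⟧ ≡ suc i ℕ.⊓ j
  ⊓-suc {i} (yes i<j) = trans (cong (_+ 1) (m≤n⇒m⊓n≡m (<⇒≤ i<j))) (trans (+-comm i 1) (sym (m≤n⇒m⊓n≡m i<j)))
  ⊓-suc     (no i≮j)  = trans (+-identityʳ _) (trans (m≥n⇒m⊓n≡n (≮⇒≥ i≮j)) (sym (m≥n⇒m⊓n≡n (m≤n⇒m≤1+n (≮⇒≥ i≮j)))))

  -- Here `M` is the number of inner vertices of a path with 4b edges, and the modulus `K` is 4b +
  -- 1.
  module Circular (b M : ℕ) (4b : suc M ≡ 4 * b) where

    K : ℕ
    K = 2 + M

    infix 4 _≈_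
    _≈_ : ℕ → ℕ → Set
    x ≈ y = x % K ≡ y % K

    +-≈ : ∀ {x y} z → x ≈ y → x + z ≈ y + z
    +-≈ {x} {y} z p = trans (%-distribˡ-+ x z K) (trans (cong (λ w → (w + z % K) % K) p) (sym (%-distribˡ-+ y z K)))

    around : ∀ x → x + (b + 3 * b + 1) ≈ x
    around x = trans (cong (λ n → (x + n) % K) (trans (lemma b) (cong suc (sym 4b)))) ([m+n]%n≡m%n x K)
      where
      lemma : ∀ b → b + 3 * b + 1 ≡ suc (4 * b)
      lemma = solve-∀

    data Step (x y : ℕ) : Set where
      short : x + b ≈ y → Step x y
      long  : x + b + 1 ≈ y → Step x y

    Step-cong : ∀ {x y x′ y′} → x ≈ x′ → y ≈ y′ → Step x y → Step x′ y′
    Step-cong {x} {y} {x′} {y′} p q (short r) = short (trans (sym (+-≈ {x} {x′} b p)) (trans r q))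
    Step-cong {x} {y} {x′} {y′} p q (long r) = long (trans (sym (+-≈ {x + b} {x′ + b} 1 (+-≈ {x} {x′} b p))) (trans r q))

    forward : ∀ x (s : Bool) → Step x (x + b + ⟦ s ⟧)
    forward x true  = long refl
    forward x false = short (cong (_% K) (sym (+-identityʳ (x + b))))

    -- Against an arc the displacements are -b - 1 and -b, that is 3b and 3b + 1 modulo `K`: again
    -- two consecutive values.
    backward : ∀ x (s : Bool) → Step (x + 3 * b + ⟦ s ⟧) x
    backward x true  = short (trans (cong (_% K) (lemma x b)) (around x))
      where
      lemma : ∀ x b → x + 3 * b + 1 + b ≡ x + (b + 3 * b + 1)
      lemma = solve-∀
    backward x false = long (trans (cong (_% K) (lemma x b)) (around x))
      where
      lemma : ∀ x b → x + 3 * b + 0 + b + 1 ≡ x + (b + 3 * b + 1)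
      lemma = solve-∀

    reach : ∀ x y → ∃ λ j → j ≤ suc M × x + j ≈ y
    -- Since `suc M` is -1 modulo `K`, this `j` is the remainder of y - x.
    reach x y = j , s≤s⁻¹ (m%n<n (y + suc M * x) K) , (begin
      (x + j) % K                     ≡⟨ cong (_% K) (+-comm x j) ⟩
      (j + x) % K                     ≡⟨ +-≈ {j} {y + suc M * x} x (m%n%n≡m%n (y + suc M * x) K) ⟩
      (y + suc M * x + x) % K         ≡⟨ cong (_% K) (lemma x y M) ⟩
      (y + x * K) % K                 ≡⟨ [m+kn]%n≡m%n y x K ⟩
      y % K                           ∎)
      where
      open ≡-Reasoning
      j = (y + suc M * x) % K
      lemma : ∀ x y m → y + suc m * x + x ≡ y + x * (2 + m)
      lemma = solve-∀

    module _ (G : OrientedGraph) where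
      open OrientedGraph G

      Fits : (V → ℕ) → V → V → Set
      Fits h x y = (x ⟶ y → Step (h x) (h y)) × (y ⟶ x → Step (h y) (h x))

      Fits-cong : ∀ {h h′ : V → ℕ} {x y} → h x ≈ h′ x → h y ≈ h′ y → Fits h x y → Fits h′ x y
      Fits-cong p q (f , g) = Step-cong p q ∘ f , Step-cong q p ∘ g

      -- The smaller of the two displacements from `x` to `y`; an edge that is no arc from `x` to
      -- `y` is traversed backwards.
      shift : V → V → ℕ
      shift x y = if arc x y then b else 3 * b

      shift-fits : ∀ {h x y} (s : Bool) → h x + shift x y + ⟦ s ⟧ ≈ h y → Fits h x y
      shift-fits {h} {x} {y} s p with arc x y in eq
      ... | true  = (λ _ → Step-cong refl p (forward (h x) s)) , (λ a → contradiction a (asym (true⇒T eq)))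
      ... | false = (λ ()) , (λ _ → Step-cong p refl (backward (h x) s))

      ColoringOn : (V → Bool) → Set
      ColoringOn U = ∃ λ h → ∀ x y → U x ≡ true → U y ≡ true → x ~ y → Fits h x y

      without : (V → Bool) → (V → Bool) → V → Bool
      without U W x = U x ∧ not (W x)

      without-true : ∀ {U W x} → U x ≡ true → W x ≡ false → without U W x ≡ true
      without-true p q rewrite p | q = refl

      without-< : ∀ {U W x} → U x ≡ true → W x ≡ true → count (without U W) < count U
      without-< {U} {W} {x} x∈U x∈W = count-< {P = without U W} {Q = U} {x = x} (λ t → true⇒T (proj₁ (∧-true (T⇒true t)))) (true⇒T x∈U) gone
        where
        gone : ¬ T (U x ∧ not (W x))
        gone rewrite x∈W | Bool.∧-zeroʳ (U x) = λ ()

      module _ (U : V → Bool) where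
        open Induced G U

        -- An edge avoiding `W` keeps the colours of both ends, so only edges that meet `W` have to
        -- be checked.
        recolor : ∀ W (h : V → ℕ) ((h′ , ok) : ColoringOn (without U W)) → (∀ x → W x ≡ false → h x ≡ h′ x) →
                  (∀ {x y} → W x ≡ true → T (neighbour x y) → Fits h x y) → ColoringOn U
        recolor W h (h′ , ok) same at-W = h , fits
          where
          fits : ∀ x y → U x ≡ true → U y ≡ true → x ~ y → Fits h x y
          fits x y x∈U y∈U a with W x in p | W y in q
          ... | true  | _     = at-W p (neighbour⇒ x∈U y∈U a)
          ... | false | true  = swap (at-W q (neighbour⇒ y∈U x∈U (~-sym G a)))
          ... | false | false = Fits-cong {h′} {h} {x} {y} (cong (_% K) (sym (same x p))) (cong (_% K) (sym (same y q)))
                                  (ok x y (without-true {U} {W} {x} x∈U p) (without-true {U} {W} {y} y∈U q) a)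

        extend-leaf : ∀ x → degree x < 2 → ColoringOn (without U (λ y → does (y ≟ x))) → ColoringOn U
        extend-leaf x deg C@(h′ , _) with any? (λ y → T? (neighbour x y))
        ... | no none = recolor _ h′ C (λ _ _ → refl) alone
          where
          alone : ∀ {y z} → does (y ≟ x) ≡ true → T (neighbour y z) → Fits h′ y z
          alone {y} p t with y ≟ x
          ... | yes refl = contradiction (_ , t) none
        ... | yes (y , t) = recolor _ h C same at-x
          where
          y∈U = proj₁ (proj₂ (neighbour⇐ t))
          x~y = proj₂ (proj₂ (neighbour⇐ {x} {y} t))
          h : V → ℕ
          -- Either displacement from the only neighbour is admissible; the smaller is taken.
          h z = if does (z ≟ x) then h′ y + shift y x + ⟦ false ⟧ else h′ z
          same : ∀ z → does (z ≟ x) ≡ false → h z ≡ h′ z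
          same z p rewrite p = refl
          hy : h y ≡ h′ y
          hy = same y (dec-false (y ≟ x) λ { refl → loopless G x~y })
          hx : h x ≡ h′ y + shift y x + ⟦ false ⟧
          hx rewrite dec-true (x ≟ x) refl = refl
          edge : Fits h x y
          edge = swap (shift-fits {h} {y} {x} false (cong (_% K) (trans (cong (λ n → n + shift y x + 0) hy) (sym hx))))
          at-x : ∀ {z w} → does (z ≟ x) ≡ true → T (neighbour z w) → Fits h z w
          at-x {z} {w} p s with does-true (z ≟ x) p | w ≟ y
          ... | refl | yes refl = edge
          ... | refl | no w≢y   = contradiction (degree≥2 {x} s t w≢y) (<⇒≱ deg)

        module _ {g} (girth : Girth≥ g G) (M<g : suc M < g) (t : Thread M) where
          open Thread t

          v : ℕ → V
          v = vertex

          distinct : ∀ {i j} → i < j → j ≤ suc M → v i ≢ v j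
          distinct {i} {j} i<j j≤ p = walk-distinct G girth walk (j ∸ i) (m<n⇒0<n∸m i<j) (≤-<-trans (m∸n≤m j i) (≤-<-trans j≤ M<g)) {i}
            (trans p (cong v (sym (m+[n∸m]≡n (<⇒≤ i<j)))))

          inner? : ∀ x → Dec (∃ λ (i : Fin M) → v (suc (toℕ i)) ≡ x)
          inner? x = any? λ i → v (suc (toℕ i)) ≟ x

          interior : V → Bool
          interior x = does (inner? x)

          only : ∀ i {y} → i < M → T (neighbour (v (suc i)) y) → y ≡ v i ⊎ y ≡ v (2 + i)
          only i {y} i<M s with y ≟ v i | y ≟ v (2 + i)
          ... | yes p | _     = inj₁ p
          ... | no _  | yes q = inj₂ q
          ... | no p  | no q  = contradiction (degree≥3 {v (suc i)} s (neighbour⇒ (inU (suc i)) (inU i) (~-sym G (Walk.adjacent walk i)))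
                                  (neighbour⇒ (inU (suc i)) (inU (2 + i)) (Walk.adjacent walk (suc i))) p q (Walk.turn walk i)) (<⇒≱ (s≤s (thin i i<M)))

          interior-not : ∀ j → (∀ {i} → i < M → v (suc i) ≢ v j) → interior (v j) ≡ false
          interior-not j ne = dec-false (inner? (v j)) λ (i , p) → ne (toℕ<n i) p

          extend-thread : ColoringOn (without U interior) → ColoringOn U
          extend-thread C@(h′ , _) = recolor interior h C same at-interior
            where
            total : ℕ → ℕ
            total zero    = 0
            total (suc i) = total i + shift (v i) (v (suc i))
            goal = reach (h′ (v 0) + total (suc M)) (h′ (v (suc M)))
            j = proj₁ goal
            -- The first j steps take the longer of the two admissible lengths.
            p : ℕ → ℕ
            p zero    = h′ (v 0)
            p (suc i) = p i + shift (v i) (v (suc i)) + ⟦ does (i <? j) ⟧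
            -- The last summand is the number of long steps among the first `i`. At the far end it
            -- equals `j`, because `j ≤ suc M`.
            p-total : ∀ i → p i ≡ h′ (v 0) + total i + (i ℕ.⊓ j)
            p-total zero    = sym (trans (+-identityʳ _) (+-identityʳ _))
            p-total (suc i) = trans (cong (λ n → n + s + ⟦ does (i <? j) ⟧) (p-total i)) (trans (lemma (h′ (v 0)) (total i) (i ℕ.⊓ j) s ⟦ does (i <? j) ⟧)
                                (cong (h′ (v 0) + (total i + s) +_) (⊓-suc (i <? j))))
              where
              s = shift (v i) (v (suc i))
              lemma : ∀ a t m s e → a + t + m + s + e ≡ a + (t + s) + (m + e)
              lemma = solve-∀
            p-end : p (suc M) ≈ h′ (v (suc M))
            p-end = trans (cong (_% K) (trans (p-total (suc M)) (cong (h′ (v 0) + total (suc M) +_) (m≥n⇒m⊓n≡n (proj₁ (proj₂ goal)))))) (proj₂ (proj₂ goal))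
            h : V → ℕ
            h x with inner? x
            ... | yes (i , _) = p (suc (toℕ i))
            ... | no _        = h′ x
            same : ∀ x → interior x ≡ false → h x ≡ h′ x
            same x e with inner? x
            ... | no _ = refl
            h-inner : ∀ i → i < M → h (v (suc i)) ≡ p (suc i)
            h-inner i i<M with inner? (v (suc i))
            ... | no none = contradiction (fromℕ< i<M , cong (v ∘ suc) (toℕ-fromℕ< i<M)) none
            ... | yes (i′ , e) with <-cmp (toℕ i′) i
            ...   | tri< l _ _ = contradiction e (distinct (s≤s l) (m≤n⇒m≤1+n i<M))
            ...   | tri≈ _ q _ = cong (p ∘ suc) q
            ...   | tri> _ _ l = contradiction (sym e) (distinct (s≤s l) (m≤n⇒m≤1+n (toℕ<n i′)))
            h-path : ∀ i → i ≤ suc M → h (v i) ≈ p i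
            h-path zero _ = cong (_% K) (same (v 0) (interior-not 0 λ i<M e → distinct z<s (m≤n⇒m≤1+n i<M) (sym e)))
            h-path (suc i) (s≤s i≤M) with m≤n⇒m<n∨m≡n i≤M
            ... | inj₁ i<M  = cong (_% K) (h-inner i i<M)
            -- The far end keeps its old colour, which agrees with `p` only modulo `K`; therefore
            -- the claim is a congruence.
            ... | inj₂ refl = trans (cong (_% K) (same (v (suc M)) (interior-not (suc M) λ i<M e → distinct (s≤s i<M) ≤-refl e))) (sym p-end)
            fits-path : ∀ i → i ≤ M → Fits h (v i) (v (suc i))
            fits-path i i≤M = shift-fits {h} {v i} {v (suc i)} (does (i <? j)) (trans (+-≈ {h (v i) + shift (v i) (v (suc i))} {p i + shift (v i) (v (suc i))} _ (+-≈ {h (v i)} {p i} (shift (v i) (v (suc i))) (h-path i (m≤n⇒m≤1+n i≤M)))) (sym (h-path (suc i) (s≤s i≤M))))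
            at-interior : ∀ {x y} → interior x ≡ true → T (neighbour x y) → Fits h x y
            at-interior {x} {y} e s with does-true (inner? x) e
            ... | i , refl with only (toℕ i) (toℕ<n i) s
            ...   | inj₁ refl = swap (fits-path (toℕ i) (<⇒≤ (toℕ<n i)))
            ...   | inj₂ refl = fits-path (suc (toℕ i)) (toℕ<n i)

      module _ {g} (0<M : 0 < M) (6M≤g : 6 * M ≤ g) (M<g : suc M < g) (planar : Planar G) (girth : Girth≥ g G) where

        -- Induction on a bound for the number of vertices: a vertex of degree at most 1 is deleted
        -- if there is one, otherwise minimum degree 2 holds and the interior of a thread is
        -- deleted.
        coloringOn : ∀ n U → count U ≤ n → ColoringOn U
        coloringOn n U U≤n with any? (λ x → T? (U x))
        ... | no none = (λ _ → 0) , λ x _ x∈U _ _ → contradiction (x , true⇒T x∈U) none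
        coloringOn zero U U≤n | yes (x , t) = contradiction (≤-trans (count-< {P = λ _ → false} {Q = U} (λ ()) t (λ ())) U≤n) λ ()
        coloringOn (suc n) U U≤n | yes (x , t) with any? (λ x → T? (U x ∧ (Induced.degree G U x ℕ.<ᵇ 2)))
        ... | yes (y , s) = extend-leaf U y (<ᵇ⇒< _ 2 (true⇒T (proj₂ (∧-true {U y} (T⇒true s)))))
                              (coloringOn n _ (s≤s⁻¹ (<-≤-trans (without-< {U} {_} {y} (proj₁ (∧-true {U y} (T⇒true s))) (dec-true (y ≟ y) refl)) U≤n)))
        ... | no none = extend-thread U girth M<g thread
                          -- By `0<M` the vertex at position 1 is interior, so the set really
                          -- shrinks.
                          (coloringOn n _ (s≤s⁻¹ (<-≤-trans (without-< {U} {_} {vertex 1} (inU 1) (dec-true (inner? U girth M<g thread (vertex 1)) (fromℕ< 0<M , cong (vertex ∘ suc) (toℕ-fromℕ< 0<M)))) U≤n)))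
          where
          min : ∀ y → U y ≡ true → 2 ≤ Induced.degree G U y
          min y y∈U = ≮⇒≥ λ d<2 → none (y , true⇒T (cong₂ _∧_ y∈U (T⇒true (<⇒<ᵇ d<2))))
          thread : Induced.Thread G U M
          thread = Induced.Rotation.thread-exists G U (proj₁ planar) 6M≤g girth (proj₂ planar) min (T⇒true t)
          open Induced.Thread thread

        circular-coloring : ∃ λ (h : V → ℕ) → ∀ {x y} → x ⟶ y → Step (h x) (h y)
        circular-coloring with coloringOn _ (λ _ → true) ≤-refl
        ... | h , ok = h , λ {x} {y} a → proj₁ (ok x y refl refl (fwd a)) a

-- Existence of minimal fold numbers.

module FoldNumbers where

  open import Defs hiding (_≤_)
  open import Data.Bool.Properties using (T?)
  open import Data.Integer.Base using (+_)
  open import Data.Rational.Base using (_/_)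
  open import Data.Fin.Base using (zero; suc)
  open import Data.Fin.Properties using (all?)
  open import Data.Fin.Subset using (Subset; ∣_∣; _∩_; Empty; Nonempty)
  open import Data.Fin.Subset.Properties using (anySubset?; nonempty?)
  open import Data.Nat.Base as ℕ using (ℕ; zero; suc; _≤_; _<_; NonZero)
  open import Data.Nat.Properties
  open import Data.Product.Base using (∃; _×_; _,_)
  open import Data.Sum.Base using (_⊎_; inj₁; inj₂)
  open import Data.Vec.Base using (Vec; []; _∷_; lookup; tabulate)
  open import Data.Vec.Properties using (lookup∘tabulate)
  open import Function.Base using (_∘_)
  open import Relation.Binary.PropositionalEquality
  open import Relation.Nullary using (¬_; Dec; yes; no; contradiction; ¬?)
  open import Relation.Nullary.Decidable using (_×-dec_; _→-dec_; map′)
  open import Relation.Unary using (Decidable)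

  least : ∀ {P : ℕ → Set} → Decidable P → ∀ {n} → P n → ∃ λ m → P m × (∀ {k} → P k → m ≤ k)
  least {P} P? {n} p with search (suc n)
    where
    search : ∀ n → (∃ λ m → P m × (∀ {k} → P k → m ≤ k)) ⊎ (∀ {k} → k < n → ¬ P k)
    search zero = inj₂ λ ()
    search (suc n) with search n
    ... | inj₁ found = inj₁ found
    ... | inj₂ none with P? n
    ...   | yes p = inj₁ (n , p , λ q → ≮⇒≥ λ k<n → none k<n q)
    ...   | no ¬p = inj₂ λ k<1+n q → case (m≤n⇒m<n∨m≡n (ℕ.s≤s⁻¹ k<1+n)) q
      where
      case : ∀ {k} → k < n ⊎ k ≡ n → ¬ P k
      case (inj₁ k<n)  = none k<n
      case (inj₂ refl) = ¬p
  ... | inj₁ found = found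
  ... | inj₂ none  = contradiction p (none ≤-refl)

  anyVec? : ∀ {k} n {P : Vec (Subset k) n → Set} → Decidable P → Dec (∃ P)
  anyVec? zero    P? = map′ ([] ,_) (λ { ([] , p) → p }) (P? [])
  anyVec? (suc n) P? = map′ (λ (s , v , p) → s ∷ v , p) (λ { (s ∷ v , p) → s , v , p })
                         (anySubset? λ s → anyVec? n λ v → P? (s ∷ v))

  module _ (G : OrientedGraph) where
    open OrientedGraph G

    IsFold : (b k : ℕ) → (V → Subset k) → Set
    IsFold b k f = (∀ x → ∣ f x ∣ ≡ b) × (∀ x y → x ⟶ y → Empty (f x ∩ f y)) ×
                   (∀ x y z w → x ⟶ y → z ⟶ w → Nonempty (f x ∩ f w) → Empty (f y ∩ f z))

    isFold? : ∀ b k → Decidable (IsFold b k)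
    isFold? b k f =
      all? (λ x → ∣ f x ∣ ≟ b) ×-dec
      all? (λ x → all? λ y → T? _ →-dec ¬? (nonempty? _)) ×-dec
      all? (λ x → all? λ y → all? λ z → all? λ w → T? _ →-dec T? _ →-dec nonempty? _ →-dec ¬? (nonempty? _))

    isFold-cong : ∀ {b k f g} → (∀ x → f x ≡ g x) → IsFold b k f → IsFold b k g
    isFold-cong f≗g (s , d , o) =
      (λ x → trans (cong ∣_∣ (sym (f≗g x))) (s x)) ,
      (λ x y a → subst₂ (λ p q → Empty (p ∩ q)) (f≗g x) (f≗g y) (d x y a)) ,
      (λ x y z w a a′ ne → subst₂ (λ p q → Empty (p ∩ q)) (f≗g y) (f≗g z)
        (o x y z w a a′ (subst₂ (λ p q → Nonempty (p ∩ q)) (sym (f≗g x)) (sym (f≗g w)) ne)))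

    foldColoring? : ∀ b k → Dec (FoldColoring G b k)
    foldColoring? b k = map′ to from (anyVec? order (isFold? b k ∘ lookup))
      where
      to : (∃ λ v → IsFold b k (lookup v)) → FoldColoring G b k
      to (v , s , d , o) = record { color = lookup v ; size = s ; disjoint = d _ _ ; oriented = o _ _ _ _ }
      from : FoldColoring G b k → ∃ λ v → IsFold b k (lookup v)
      from C = tabulate color , isFold-cong (λ x → sym (lookup∘tabulate color x)) (size , (λ _ _ → disjoint) , λ _ _ _ _ → oriented)
        where open FoldColoring C

    -- The infimum `χ*ₒ` ranges over minimal `k` only. Colourability is decidable, so the minimum
    -- below a given colouring is found by search.
    foldNumber : ∀ {b k} .{{_ : NonZero b}} → FoldColoring G b k →
                 ∃ λ m → m ≤ k × ∃ λ (n : FoldNumber G) → FoldNumber.ratio n ≡ + m / b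
    foldNumber {b} C with least (foldColoring? b) C
    ... | m , D , min = m , min C , record { b = b ; k = m ; minimal = D , min } , refl

-- Fold colourings by cyclic intervals.

module Intervals where

  open import Defs hiding (_≤_)
  open Counting
  open Surfaces using (true⇒T)
  open Extend
  open import Data.Bool.Base using (Bool; true; false; T)
  open import Data.Bool.Properties using (T-irrelevant)
  open import Data.Fin.Base using (Fin; zero; suc; toℕ; fromℕ<)
  open import Data.Fin.Properties using (toℕ<n; toℕ-fromℕ<; toℕ-injective; fromℕ<-injective)
  open import Data.Fin.Subset using (Subset; ∣_∣; _∩_; _∈_; Empty; Nonempty)
  open import Data.Fin.Subset.Properties using (x∈p∩q⁻)
  open import Data.Nat.Base using (ℕ; zero; suc; _+_; _*_; _≤_; _<_; _<ᵇ_; z≤n; s≤s)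
  open import Data.Nat.DivMod
  open import Data.Nat.Properties
  open import Data.Nat.Tactic.RingSolver using (solve-∀)
  open import Data.Product.Base using (Σ; ∃; _×_; _,_; proj₁)
  open import Data.Vec.Base using (tabulate)
  open import Data.Vec.Properties using ([]=⇒lookup; lookup∘tabulate)
  open import Function.Base using (_∘_)
  open import Relation.Binary.PropositionalEquality

  ∣tabulate∣ : ∀ {n} (P : Fin n → Bool) → ∣ tabulate P ∣ ≡ count P
  ∣tabulate∣ {zero}  P = refl
  ∣tabulate∣ {suc n} P with P zero
  ... | true  = cong suc (∣tabulate∣ (P ∘ suc))
  ... | false = ∣tabulate∣ (P ∘ suc)

  module _ (b M : ℕ) (4b : suc M ≡ 4 * b) where
    open Circular b M 4b

    multiple : ∀ x k → x + k * K ≈ x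
    multiple x k = [m+kn]%n≡m%n x k K

    -- Adding `suc M * z` amounts to subtracting `z` modulo `K`.
    cancel : ∀ x y z → x + z ≈ y + z → x ≈ y
    cancel x y z p = begin
      x % K                     ≡⟨ multiple x z ⟨
      (x + z * K) % K           ≡⟨ cong (_% K) (lemma x z M) ⟩
      (x + z + suc M * z) % K   ≡⟨ +-≈ {x + z} {y + z} (suc M * z) p ⟩
      (y + z + suc M * z) % K   ≡⟨ cong (_% K) (lemma y z M) ⟨
      (y + z * K) % K           ≡⟨ multiple y z ⟩
      y % K                     ∎
      where
      open ≡-Reasoning
      lemma : ∀ x z m → x + z * (2 + m) ≡ x + z + suc m * z
      lemma = solve-∀

    small : ∀ {x y} → x < K → y < K → x ≈ y → x ≡ y
    small x<K y<K p = trans (sym (m<n⇒m%n≡m x<K)) (trans p (m<n⇒m%n≡m y<K))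

    -- The remainder of c - h, with `suc M` in the role of -1; an interval consists of the colours
    -- whose offset is below `b`.
    offset : ℕ → ℕ → ℕ
    offset h c = (c + suc M * h) % K

    offset-spec : ∀ h c → offset h c + h ≈ c
    offset-spec h c = begin
      (offset h c + h) % K         ≡⟨ +-≈ {offset h c} {c + suc M * h} h (m%n%n≡m%n (c + suc M * h) K) ⟩
      (c + suc M * h + h) % K      ≡⟨ cong (_% K) (lemma c h M) ⟩
      (c + h * K) % K              ≡⟨ multiple c h ⟩
      c % K                        ∎
      where
      open ≡-Reasoning
      lemma : ∀ c h m → c + suc m * h + h ≡ c + h * (2 + m)
      lemma = solve-∀

    covers : ℕ → Fin K → Bool
    covers h c = offset h (toℕ c) <ᵇ b

    interval : ℕ → Subset K
    interval h = tabulate (covers h)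

    b<K : b < K
    b<K = s≤s (≤-trans (m≤m+n b (3 * b)) (≤-reflexive (sym 4b)))

    ∣interval∣ : ∀ h → ∣ interval h ∣ ≡ b
    ∣interval∣ h = trans (∣tabulate∣ (covers h)) (≤-antisym (count-≤ (covers h) f f-injective) (≤-count (covers h) g g-injective))
      where
      f : Σ (Fin K) (T ∘ covers h) → Fin b
      f (c , t) = fromℕ< (<ᵇ⇒< _ b t)
      f-injective : ∀ {x y} → f x ≡ f y → x ≡ y
      f-injective {c , t} {d , s} p with toℕ-injective {i = c} {d} (small (toℕ<n c) (toℕ<n d)
          (trans (sym (offset-spec h (toℕ c))) (trans (cong (λ o → (o + h) % K) (fromℕ<-injective _ _ (<ᵇ⇒< _ b t) (<ᵇ⇒< _ b s) p)) (offset-spec h (toℕ d)))))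
      ... | refl = cong (c ,_) (T-irrelevant t s)
      point : Fin b → Fin K
      point i = fromℕ< (m%n<n (toℕ i + h) K)
      offset-point : ∀ i → offset h (toℕ (point i)) ≡ toℕ i
      offset-point i = small (m%n<n (toℕ (point i) + suc M * h) K) (<-trans (toℕ<n i) b<K) (cancel (offset h (toℕ (point i))) (toℕ i) h
        (trans (offset-spec h (toℕ (point i))) (trans (cong (_% K) (toℕ-fromℕ< (m%n<n (toℕ i + h) K))) (m%n%n≡m%n (toℕ i + h) K))))
      g : Fin b → Σ (Fin K) (T ∘ covers h)
      g i = point i , <⇒<ᵇ (subst (_< b) (sym (offset-point i)) (toℕ<n i))
      g-injective : ∀ {i j} → g i ≡ g j → i ≡ j
      g-injective {i} {j} p = toℕ-injective (trans (sym (offset-point i)) (trans (cong (offset h ∘ toℕ ∘ proj₁) p) (offset-point j)))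

    ∈-interval : ∀ {h c} → c ∈ interval h → ∃ λ i → i < b × i + h ≈ toℕ c
    ∈-interval {h} {c} p = offset h (toℕ c) , <ᵇ⇒< _ b (true⇒T (trans (sym (lookup∘tabulate (covers h) c)) ([]=⇒lookup p))) , offset-spec h (toℕ c)

    jump : ∀ {x y} → Step x y → ∃ λ s → s ≤ 1 × x + b + s ≈ y
    jump {x} (short p) = 0 , z≤n , trans (cong (_% K) (+-identityʳ (x + b))) p
    jump (long p)  = 1 , ≤-refl , p

    module _ (G : OrientedGraph) {h : OrientedGraph.V G → ℕ}
             (circular : ∀ {x y} → OrientedGraph._⟶_ G x y → Step (h x) (h y)) where
      open OrientedGraph G

      -- A common colour at positions i and j of the two intervals gives i ≡ b + s + j. The left
      -- side is below b, the right side lies between b and 2b, and both are below `K`.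
      intervals-disjoint : ∀ {x y} → x ⟶ y → Empty (interval (h x) ∩ interval (h y))
      intervals-disjoint {x} {y} a (c , c∈) with x∈p∩q⁻ (interval (h x)) (interval (h y)) c∈
      ... | c∈x , c∈y with ∈-interval c∈x | ∈-interval c∈y | jump (circular a)
      ...   | i , i<b , p | j , j<b , q | s , s≤1 , r = <⇒≢ (<-≤-trans i<b (m≤m+n b (s + j))) (small (<-trans i<b b<K) bound (cancel i (b + (s + j)) (h x) (begin
        (i + h x) % K                 ≡⟨ trans p (sym q) ⟩
        (j + h y) % K                 ≡⟨ cong (_% K) (+-comm j (h y)) ⟩
        (h y + j) % K                 ≡⟨ +-≈ {h x + b + s} {h y} j r ⟨
        (h x + b + s + j) % K         ≡⟨ cong (_% K) (lemma (h x) b s j) ⟩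
        (b + (s + j) + h x) % K       ∎)))
        where
        open ≡-Reasoning
        lemma : ∀ x b s j → x + b + s + j ≡ b + (s + j) + x
        lemma = solve-∀
        bound : b + (s + j) < K
        bound = s≤s (≤-trans (+-monoʳ-≤ b (≤-trans (+-mono-≤ s≤1 ≤-refl) (≤-trans j<b (m≤m+n b (b + (b + 0)))))) (≤-reflexive (sym 4b)))

      -- The congruences for two common colours add up to i + j′ ≡ 2b + (s + j) + (s′ + i′). The
      -- left side is below 2b and the right side between 2b and 4b, so the modulus 4b + 1 keeps
      -- them apart.
      intervals-oriented : ∀ {x y z w} → x ⟶ y → z ⟶ w → Nonempty (interval (h x) ∩ interval (h w)) → Empty (interval (h y) ∩ interval (h z))
      intervals-oriented {x} {y} {z} {w} a a′ (c , c∈) (d , d∈)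
        with x∈p∩q⁻ (interval (h x)) (interval (h w)) c∈ | x∈p∩q⁻ (interval (h y)) (interval (h z)) d∈
      ... | c∈x , c∈w | d∈y , d∈z with ∈-interval c∈x | ∈-interval c∈w | ∈-interval d∈y | ∈-interval d∈z | jump (circular a) | jump (circular a′)
      ...   | i , i<b , p | i′ , i′<b , p′ | j , j<b , q | j′ , j′<b , q′ | s , s≤1 , r | s′ , s′≤1 , r′ =
        <⇒≢ (<-≤-trans lhs<2b (m≤m+n (b + b) _)) (small (<-trans lhs<2b 2b<K) rhs<K
          (cancel (i + j′) (b + b + (s + j + (s′ + i′))) (h x + h z) (begin
            (i + j′ + (h x + h z)) % K                            ≡⟨ cong (_% K) (e₁ i j′ (h x) (h z)) ⟩
            (i + h x + (j′ + h z)) % K                            ≡⟨ +-≈ {i + h x} {i′ + h w} (j′ + h z) (trans p (sym p′)) ⟩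
            (i′ + h w + (j′ + h z)) % K                           ≡⟨ cong (_% K) (+-comm (i′ + h w) (j′ + h z)) ⟩
            (j′ + h z + (i′ + h w)) % K                           ≡⟨ +-≈ {j′ + h z} {j + h y} (i′ + h w) (trans q′ (sym q)) ⟩
            (j + h y + (i′ + h w)) % K                            ≡⟨ cong (_% K) (e₂ j (h y) i′ (h w)) ⟩
            (h y + (j + i′ + h w)) % K                            ≡⟨ +-≈ {h x + b + s} {h y} (j + i′ + h w) r ⟨
            (h x + b + s + (j + i′ + h w)) % K                    ≡⟨ cong (_% K) (e₃ (h x) b s j i′ (h w)) ⟩
            (h w + (h x + b + s + j + i′)) % K                    ≡⟨ +-≈ {h z + b + s′} {h w} (h x + b + s + j + i′) r′ ⟨
            (h z + b + s′ + (h x + b + s + j + i′)) % K           ≡⟨ cong (_% K) (e₄ (h z) b s′ (h x) s j i′) ⟩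
            (b + b + (s + j + (s′ + i′)) + (h x + h z)) % K       ∎)))
        where
        open ≡-Reasoning
        e₁ : ∀ i j x z → i + j + (x + z) ≡ i + x + (j + z)
        e₁ = solve-∀
        e₂ : ∀ j y i w → j + y + (i + w) ≡ y + (j + i + w)
        e₂ = solve-∀
        e₃ : ∀ x b s j i w → x + b + s + (j + i + w) ≡ w + (x + b + s + j + i)
        e₃ = solve-∀
        e₄ : ∀ z b s′ x s j i → z + b + s′ + (x + b + s + j + i) ≡ b + b + (s + j + (s′ + i)) + (x + z)
        e₄ = solve-∀
        four : ∀ b → b + b + (b + b) ≡ 4 * b
        four = solve-∀
        lhs<2b : i + j′ < b + b
        lhs<2b = +-mono-<-≤ i<b (<⇒≤ j′<b)
        2b<K : b + b < K
        2b<K = s≤s (≤-trans (m≤m+n (b + b) (b + b)) (≤-reflexive (trans (four b) (sym 4b))))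
        rhs<K : b + b + (s + j + (s′ + i′)) < K
        rhs<K = s≤s (≤-trans (+-monoʳ-≤ (b + b) (+-mono-≤ (≤-trans (+-monoˡ-≤ j s≤1) j<b) (≤-trans (+-monoˡ-≤ i′ s′≤1) i′<b))) (≤-reflexive (trans (four b) (sym 4b))))

      circular⇒fold : FoldColoring G b K
      circular⇒fold = record
        { color    = interval ∘ h
        ; size     = ∣interval∣ ∘ h
        ; disjoint = intervals-disjoint
        ; oriented = intervals-oriented
        }

-- Rational estimates near 4.

module Ratios where

  open import Data.Integer.Base as ℤ using (ℤ; +_; -[1+_]; +<+)
  import Data.Integer.Properties as ℤₚ
  open import Data.Nat.Base as ℕ using (ℕ; zero; suc; NonZero; z≤n; s≤s)
  import Data.Nat.Properties as ℕₚ
  open import Data.Nat.Tactic.RingSolver using (solve-∀)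
  open import Data.Product.Base using (∃; _,_)
  open import Data.Rational.Base using (mkℚ; 0ℚ; _/_; _+_; _<_; *<*)
  open import Data.Rational.Properties using (toℚᵘ-fromℚᵘ; toℚᵘ-mono-<; toℚᵘ-cancel-<; toℚᵘ-homo-+)
  open import Data.Rational.Unnormalised.Base using (mkℚᵘ; *<*)
  import Data.Rational.Unnormalised.Properties as ℚᵘₚ
  open import Relation.Binary.PropositionalEquality

  /<4⇒<4* : ∀ k b .{{_ : NonZero b}} → + k / b < + 4 / 1 → k ℕ.< 4 ℕ.* b
  /<4⇒<4* k b@(suc b-1) p with ℚᵘₚ.<-respˡ-≃ (toℚᵘ-fromℚᵘ (mkℚᵘ (+ k) b-1)) (toℚᵘ-mono-< p)
  ... | *<* q = ℤₚ.drop‿+<+ (subst₂ ℤ._<_ (ℤₚ.*-identityʳ (+ k)) (sym (ℤₚ.pos-* 4 b)) q)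

  -- With d the denominator of ε, any b > d satisfies 1 / b < ε.
  near4 : ∀ ε → 0ℚ < ε → ∃ λ b → ∀ k → k ℕ.≤ suc (4 ℕ.* suc b) → + k / suc b < + 4 / 1 + ε
  near4 (mkℚ -[1+ _ ] _ _) (*<* ())
  near4 (mkℚ (+ zero) _ _) (*<* (+<+ ()))
  near4 ε@(mkℚ (+ suc n) d-1 _) _ = suc d-1 , λ k k≤ → toℚᵘ-cancel-<
    (ℚᵘₚ.<-respˡ-≃ (ℚᵘₚ.≃-sym (toℚᵘ-fromℚᵘ (mkℚᵘ (+ k) (suc d-1))))
    (ℚᵘₚ.<-respʳ-≃ (ℚᵘₚ.≃-sym (toℚᵘ-homo-+ (+ 4 / 1) ε))
    (*<* (subst₂ ℤ._<_ (ℤₚ.pos-* k (1 ℕ.* d)) (rhs k) (+<+ (bound k k≤))))))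
    where
    d = suc d-1
    b = suc d
    rhs : ∀ k → + ((4 ℕ.* d ℕ.+ suc n ℕ.* 1) ℕ.* b) ≡ (+ 4 ℤ.* + d ℤ.+ + suc n ℤ.* + 1) ℤ.* + b
    rhs k = trans (ℤₚ.pos-* (4 ℕ.* d ℕ.+ suc n ℕ.* 1) b) (cong (ℤ._* + b)
      (trans (ℤₚ.pos-+ (4 ℕ.* d) (suc n ℕ.* 1)) (cong₂ ℤ._+_ (ℤₚ.pos-* 4 d) (ℤₚ.pos-* (suc n) 1))))
    bound : ∀ k → k ℕ.≤ suc (4 ℕ.* b) → k ℕ.* (1 ℕ.* d) ℕ.< (4 ℕ.* d ℕ.+ suc n ℕ.* 1) ℕ.* b
    bound k k≤ = begin-strict
      k ℕ.* (1 ℕ.* d)                          ≡⟨ cong (k ℕ.*_) (ℕₚ.*-identityˡ d) ⟩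
      k ℕ.* d                                  ≤⟨ ℕₚ.*-monoˡ-≤ d k≤ ⟩
      suc (4 ℕ.* b) ℕ.* d                      <⟨ ℕₚ.n<1+n _ ⟩
      suc (suc (4 ℕ.* b) ℕ.* d)                ≡⟨ lemma d ⟩
      (4 ℕ.* d ℕ.+ 1) ℕ.* b                    ≤⟨ ℕₚ.*-monoˡ-≤ b (ℕₚ.+-monoʳ-≤ (4 ℕ.* d) (s≤s z≤n)) ⟩
      (4 ℕ.* d ℕ.+ suc n ℕ.* 1) ℕ.* b          ∎
      where
      open ℕₚ.≤-Reasoning
      lemma : ∀ d → suc (suc (4 ℕ.* suc d) ℕ.* d) ≡ (4 ℕ.* d ℕ.+ 1) ℕ.* suc d
      lemma = solve-∀

-- Colourings with fewer than 4b colours along alternating paths.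

module Zigzag where

  open import Defs hiding (_≤_)
  open import Data.Bool.Base using (Bool; true; false; not)
  open import Data.Fin.Base using (zero; suc)
  open import Data.Fin.Subset using (Subset; ∣_∣; _∩_; _∪_; Empty; Nonempty; inside; outside)
  open import Data.Fin.Subset.Properties using (nonempty?; x∈p∩q⁺; x∈p∩q⁻; x∈p∪q⁻; ∣p∣≤n; ∩-comm)
  open import Data.Nat.Base using (ℕ; zero; suc; _+_; _*_; _≤_; _<_; s≤s; NonZero; >-nonZero⁻¹)
  open import Data.Nat.Properties
  open import Data.Nat.Tactic.RingSolver using (solve-∀)
  open import Data.Product.Base using (_,_)
  open import Data.Sum.Base using (inj₁; inj₂)
  open import Data.Vec.Base using ([]; _∷_; here; there)
  open import Function.Base using (_∘_)
  open import Relation.Binary.PropositionalEquality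
  open import Relation.Nullary using (¬_; yes; no; contradiction)

  ∣p∪q∣-disjoint : ∀ {n} (p q : Subset n) → Empty (p ∩ q) → ∣ p ∪ q ∣ ≡ ∣ p ∣ + ∣ q ∣
  ∣p∪q∣-disjoint [] [] _ = refl
  ∣p∪q∣-disjoint (inside  ∷ p) (inside  ∷ q) e = contradiction (zero , here) e
  ∣p∪q∣-disjoint (inside  ∷ p) (outside ∷ q) e = cong suc (∣p∪q∣-disjoint p q λ (x , m) → e (suc x , there m))
  ∣p∪q∣-disjoint (outside ∷ p) (inside  ∷ q) e = trans (cong suc (∣p∪q∣-disjoint p q λ (x , m) → e (suc x , there m))) (sym (+-suc ∣ p ∣ ∣ q ∣))
  ∣p∪q∣-disjoint (outside ∷ p) (outside ∷ q) e = ∣p∪q∣-disjoint p q λ (x , m) → e (suc x , there m)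

  ∪-disjoint : ∀ {n} (p q r : Subset n) → Empty (p ∩ r) → Empty (q ∩ r) → Empty ((p ∪ q) ∩ r)
  ∪-disjoint p q r pr qr (x , m) with x∈p∩q⁻ (p ∪ q) r m
  ... | x∈p∪q , x∈r with x∈p∪q⁻ p q x∈p∪q
  ...   | inj₁ x∈p = pr (x , x∈p∩q⁺ (x∈p , x∈r))
  ...   | inj₂ x∈q = qr (x , x∈p∩q⁺ (x∈q , x∈r))

  size⇒nonempty : ∀ {n} (p : Subset n) → 0 < ∣ p ∣ → Nonempty p
  size⇒nonempty (inside  ∷ p) _ = zero , here
  size⇒nonempty (outside ∷ p) 0<p with size⇒nonempty p 0<p
  ... | x , m = suc x , there m

  even : ℕ → Bool
  even zero    = true
  even (suc n) = not (even n)

  -- This is i + 2t, arranged so that two successors split off by computation.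
  up : ℕ → ℕ → ℕ
  up zero    i = i
  up (suc t) i = suc (suc (up t i))

  ≤-up : ∀ t i → i ≤ up t i
  ≤-up zero    i = ≤-refl
  ≤-up (suc t) i = m≤n⇒m≤1+n (m≤n⇒m≤1+n (≤-up t i))

  up-suc : ∀ t i → up t (suc i) ≡ suc (up t i)
  up-suc zero    i = refl
  up-suc (suc t) i = cong (2 +_) (up-suc t i)

  not² : ∀ b → not (not b) ≡ b
  not² true  = refl
  not² false = refl

  even-up : ∀ t i → even (up t i) ≡ even i
  even-up zero    i = refl
  even-up (suc t) i = trans (not² (even (up t i))) (even-up t i)

  module Few {G : OrientedGraph} {b k} .{{_ : NonZero b}} (C : FoldColoring G b k) (k<4b : k < 4 * b) where
    open OrientedGraph G
    open FoldColoring C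

    Meet Apart : V → V → Set
    Meet  x y = Nonempty (color x ∩ color y)
    Apart x y = Empty (color x ∩ color y)

    meet-sym : ∀ {x y} → Meet x y → Meet y x
    meet-sym {x} {y} = subst Nonempty (∩-comm (color x) (color y))

    apart-sym : ∀ {x y} → Apart x y → Apart y x
    apart-sym d = d ∘ meet-sym

    meet-refl : ∀ x → Meet x x
    meet-refl x with size⇒nonempty (color x) (subst (0 <_) (sym (size x)) (>-nonZero⁻¹ b))
    ... | c , m = c , x∈p∩q⁺ (m , m)

    -- Four pairwise disjoint sets of size `b` would need 4b colours, so when five of the six pairs
    -- are disjoint the last pair must meet.
    fourth : ∀ {x y z w} → Apart x z → Apart x w → Apart y z → Apart y w → Apart z w → Meet x y
    fourth {x} {y} {z} {w} xz xw yz yw zw with nonempty? (color x ∩ color y)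
    ... | yes xy = xy
    ... | no xy  = contradiction (≤-trans (≤-reflexive (sym total)) (∣p∣≤n (((X ∪ Y) ∪ Z) ∪ W))) (<⇒≱ k<4b)
      where
      X = color x
      Y = color y
      Z = color z
      W = color w
      total : ∣ ((X ∪ Y) ∪ Z) ∪ W ∣ ≡ 4 * b
      total = begin
        ∣ ((X ∪ Y) ∪ Z) ∪ W ∣            ≡⟨ ∣p∪q∣-disjoint ((X ∪ Y) ∪ Z) W (∪-disjoint (X ∪ Y) Z W (∪-disjoint X Y W xw yw) zw) ⟩
        ∣ (X ∪ Y) ∪ Z ∣ + ∣ W ∣          ≡⟨ cong (_+ ∣ W ∣) (∣p∪q∣-disjoint (X ∪ Y) Z (∪-disjoint X Y Z xz yz)) ⟩
        ∣ X ∪ Y ∣ + ∣ Z ∣ + ∣ W ∣        ≡⟨ cong (λ n → n + ∣ Z ∣ + ∣ W ∣) (∣p∪q∣-disjoint X Y xy) ⟩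
        ∣ X ∣ + ∣ Y ∣ + ∣ Z ∣ + ∣ W ∣    ≡⟨ cong₂ _+_ (cong₂ _+_ (cong₂ _+_ (size x) (size y)) (size z)) (size w) ⟩
        b + b + b + b                    ≡⟨ lemma b ⟩
        4 * b                            ∎
        where
        open ≡-Reasoning
        lemma : ∀ b → b + b + b + b ≡ 4 * b
        lemma = solve-∀

    -- Changing the sign reverses the arc, and the colouring conditions are symmetric under reversal
    -- of all arcs. Even and odd positions of the zigzag can thus share one argument.
    Arrow : Bool → V → V → Set
    Arrow true  x y = x ⟶ y
    Arrow false x y = y ⟶ x

    arrow-flip : ∀ s {x y} → Arrow (not s) x y → Arrow s y x
    arrow-flip true  a = a
    arrow-flip false a = a

    arrow-apart : ∀ s {x y} → Arrow s x y → Apart x y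
    arrow-apart true  a = disjoint a
    arrow-apart false a = apart-sym (disjoint a)

    heads : ∀ s {x y z w} → Arrow s x y → Arrow s z w → Meet x w → Apart y z
    heads true  a a′ m = oriented a a′ m
    heads false a a′ m yz = oriented a a′ yz m

    tails : ∀ s {x y z w} → Arrow s x y → Arrow s z w → Meet y z → Apart x w
    tails true  a a′ m xw = oriented a a′ xw m
    tails false a a′ m = oriented a a′ m

    -- The middle vertex meets itself, so the orientation condition applies to the two arcs.
    two-path : ∀ s {x y z} → Arrow s x y → Arrow s y z → Apart x z
    two-path s {y = y} a a′ = tails s a a′ (meet-refl y)

    -- Even vertices of the zigzag are its sources and are entered by p′ → p → z; odd ones are its
    -- sinks and are left by z → p → p′.
    module Path (N : ℕ) (z p p′ : ℕ → V)
      (pz  : ∀ {i} → i ≤ N → Arrow (even i) (p i) (z i))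
      (p′p : ∀ {i} → i ≤ N → Arrow (even i) (p′ i) (p i))
      (zz  : ∀ {i} → suc i ≤ N → Arrow (even i) (z i) (z (suc i))) where

      -- Simultaneous induction on `t`: distance 2t + 2 uses distances 2t and 2t + 1, and distance
      -- 2t + 3 uses in addition 2t + 2.
      even-meet : ∀ t i → up t i ≤ N → Meet (z i) (z (up t i))
      odd-apart : ∀ t i → suc (up t i) ≤ N → Apart (z i) (z (suc (up t i)))

      even-meet zero    i _  = meet-refl (z i)
      -- The auxiliary pair is `z (suc i)` and its pendant neighbour `p (suc i)`, both disjoint from
      -- either end.
      even-meet (suc t) i le = fourth
        (arrow-apart s z→z)
        (two-path s z→z z→p)
        (apart-sym (subst (λ j → Apart (z (suc i)) (z (suc j))) (up-suc t i) (odd-apart t (suc i) (subst (λ j → suc j ≤ N) (sym (up-suc t i)) le))))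
        (apart-sym (heads s z→p (arrow-flip s (subst (λ e → Arrow e (z (suc (up t i))) (z (2 + up t i))) (cong not (even-up t i)) (zz le)))
          (subst (λ j → Meet (z (suc i)) (z j)) (up-suc t i) (even-meet t (suc i) (subst (_≤ N) (sym (up-suc t i)) (<⇒≤ le))))))
        (arrow-apart s z→p)
        where
        s = even i
        i<N : suc i ≤ N
        i<N = ≤-trans (s≤s (≤-up t i)) (<⇒≤ le)
        z→z : Arrow s (z i) (z (suc i))
        z→z = zz i<N
        z→p : Arrow s (z (suc i)) (p (suc i))
        z→p = arrow-flip s (pz i<N)

      odd-apart zero    i le = arrow-apart (even i) (zz le)
      -- It suffices that the pendant neighbours `p i` and `p (3 + u)` of the two ends meet. They
      -- do, as both are disjoint from the adjacent pair `z (2 + u)`, `z (3 + u)`.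
      odd-apart (suc t) i le = heads s p→z z→q (fourth
          (tails s p→z z→z (even-meet (suc t) i (<⇒≤ le)))
          (heads s p′→p (arrow-flip s (subst (λ e → Arrow e (z (suc u)) (z (2 + u))) (cong not (even-up t i)) (zz (<⇒≤ le)))) p′-meets)
          (apart-sym (arrow-apart s z→q))
          (apart-sym (two-path s z→z z→q))
          (apart-sym (arrow-apart s z→z)))
        where
        s = even i
        u = up t i
        i≤N : i ≤ N
        i≤N = ≤-trans (≤-up (suc t) i) (<⇒≤ le)
        p→z : Arrow s (p i) (z i)
        p→z = pz i≤N
        p′→p : Arrow s (p′ i) (p i)
        p′→p = p′p i≤N
        z→q : Arrow s (z (3 + u)) (p (3 + u))
        z→q = arrow-flip s (subst (λ e → Arrow e (p (3 + u)) (z (3 + u))) (cong not (even-up (suc t) i)) (pz le))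
        z→z : Arrow s (z (2 + u)) (z (3 + u))
        z→z = subst (λ e → Arrow e (z (2 + u)) (z (3 + u))) (even-up (suc t) i) (zz le)
        p′-meets : Meet (p′ i) (z (suc u))
        -- The auxiliary pair is `p i` and `z i`. This is where the length 2 of the pendant paths is
        -- used.
        p′-meets = fourth
          (arrow-apart s p′→p)
          (two-path s p′→p p→z)
          (apart-sym (tails s p→z (subst (λ e → Arrow e (z u) (z (suc u))) (even-up t i) (zz (<⇒≤ (<⇒≤ le)))) (even-meet t i (<⇒≤ (<⇒≤ (<⇒≤ le))))))
          (apart-sym (odd-apart t i (<⇒≤ (<⇒≤ le))))
          (arrow-apart s p→z)

      zigzag-unclosed : ∀ t → up t 0 ≡ N → ¬ (z 0 ⟶ z N)
      zigzag-unclosed t refl a = disjoint a (even-meet t 0 ≤-refl)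

-- A cycle with pendant paths: planarity and girth.

module Sun where

  open import Defs hiding (_≤_)
  open Counting
  open Maps
  open Surfaces
  open Zigzag using (even)
  open import Data.Bool.Base using (Bool; true; false; _∧_; _∨_; not; T)
  open import Data.Fin.Base using (Fin; zero; suc; toℕ; fromℕ; inject₁; combine; remQuot)
  open import Data.Fin.Properties using (_≟_; toℕ-injective; toℕ-fromℕ; toℕ-inject₁; toℕ≤pred[n]; remQuot-combine; combine-remQuot; injective⇒≤)
  open import Data.Fin.Relation.Unary.Top using (view; view-fromℕ; view-inject₁; ‵fromℕ; ‵inject₁)
  open import Data.Nat.Base as ℕ using (ℕ; zero; suc; _+_; _*_; _≤_; z≤n; s≤s)
  open import Data.Nat.GeneralisedArithmetic using (fold)
  open import Data.Nat.Properties hiding (_≟_)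
  open import Data.Product.Base using (∃; _×_; _,_; proj₁; proj₂)
  open import Data.Product.Properties using (≡-dec)
  open import Data.Sum.Base using (_⊎_; inj₁; inj₂)
  open import Function.Base using (_∘_; _on_)
  open import Function.Bundles using (mk⇔)
  open import Relation.Binary.Structures using (IsEquivalence)
  open import Relation.Binary.Definitions using (DecidableEquality)
  open import Relation.Binary.PropositionalEquality
  open import Relation.Binary.Construct.Closure.Equivalence as Eq using (EqClosure)
  open import Relation.Binary.Construct.Closure.ReflexiveTransitive as Star using (Star; ε; _◅_; _◅◅_)
  open import Relation.Binary.Construct.Closure.Symmetric using (fwd; bwd)
  open import Relation.Nullary using (¬_; yes; no; does; contradiction)
  open import Relation.Nullary.Decidable using (dec-true)

  prev : ∀ {n} → Fin (suc n) → Fin (suc n)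
  prev zero    = fromℕ _
  prev (suc i) = inject₁ i

  succ : ∀ {n} → Fin (suc n) → Fin (suc n)
  succ i with view i
  ... | ‵fromℕ     = zero
  ... | ‵inject₁ j = suc j

  succ-fromℕ : ∀ n → succ (fromℕ n) ≡ zero
  succ-fromℕ n rewrite view-fromℕ n = refl

  succ-inject₁ : ∀ {n} (i : Fin n) → succ (inject₁ i) ≡ suc i
  succ-inject₁ i rewrite view-inject₁ i = refl

  prev-succ : ∀ {n} (i : Fin (suc n)) → prev (succ i) ≡ i
  prev-succ i with view i
  ... | ‵fromℕ     = refl
  ... | ‵inject₁ j = refl

  succ-prev : ∀ {n} (i : Fin (suc n)) → succ (prev i) ≡ i
  succ-prev zero    = succ-fromℕ _
  succ-prev (suc i) = succ-inject₁ i

  prev²≢ : ∀ {n} → 2 ≤ n → (i : Fin (suc n)) → prev (prev i) ≢ i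
  prev²≢ (s≤s (s≤s z≤n)) zero          = λ ()
  prev²≢ (s≤s (s≤s z≤n)) (suc zero)    = λ ()
  prev²≢ (s≤s (s≤s z≤n)) (suc (suc i)) p =
    <⇒≢ (m<n+m (toℕ i) {2} ℕ.z<s) (trans (sym (trans (toℕ-inject₁ (inject₁ i)) (toℕ-inject₁ i))) (cong toℕ p))

  succ²≢ : ∀ {n} → 2 ≤ n → (i : Fin (suc n)) → succ (succ i) ≢ i
  succ²≢ 2≤n i p = prev²≢ 2≤n i (trans (cong (prev ∘ prev) (sym p)) (trans (cong prev (prev-succ (succ i))) (prev-succ i)))

  succ≢prev : ∀ {n} → 2 ≤ n → (i : Fin (suc n)) → succ i ≢ prev i
  succ≢prev 2≤n i p = succ²≢ 2≤n i (trans (cong succ p) (succ-prev i))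

  descend : ∀ {n} (i j : Fin (suc n)) → Star (λ i j → prev i ≡ j) i j
  descend {n} i j = down (toℕ i) i zero (sym (+-identityʳ _)) ◅◅ refl ◅ down (n ℕ.∸ toℕ j) (fromℕ n) j
                      (trans (toℕ-fromℕ n) (sym (m∸n+n≡m (toℕ≤pred[n] j))))
    where
    down : ∀ d i j → toℕ i ≡ d + toℕ j → Star (λ i j → prev i ≡ j) i j
    down zero    i j p rewrite toℕ-injective p = ε
    down (suc d) (suc i) j p = refl ◅ down d (inject₁ i) j (trans (toℕ-inject₁ i) (suc-injective p))

  -- A cycle of length suc N with a pendant path of length 2 at every vertex.
  -- Every vertex (i , l) owns the edge to its parent, directed to the parent
  -- iff i is even.
  module Graph (N : ℕ) (2≤N : 2 ≤ N) where

    W : Set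
    W = Fin (suc N) × Fin 3

    infix 4 _≟ʷ_
    _≟ʷ_ : DecidableEquality W
    _≟ʷ_ = ≡-dec _≟_ _≟_

    parentʷ : W → W
    parentʷ (i , zero)           = prev i , zero
    parentʷ (i , suc zero)       = i , zero
    parentʷ (i , suc (suc zero)) = i , suc zero

    -- No two vertices are each other's parents, so every edge has one owner and one direction. On
    -- the cycle this rests on its length being at least 3.
    parent²≢ : ∀ u → parentʷ (parentʷ u) ≢ u
    parent²≢ (i , zero)           p = prev²≢ 2≤N i (cong proj₁ p)
    parent²≢ (i , suc zero)       ()
    parent²≢ (i , suc (suc zero)) ()

    away : W → Bool
    away (i , _) = even (toℕ i)

    arcʷ : W → W → Bool
    arcʷ u w = (does (parentʷ u ≟ʷ w) ∧ away u) ∨ (does (parentʷ w ≟ʷ u) ∧ not (away w))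

    arcʷ⇒ : ∀ u w → T (arcʷ u w) → (parentʷ u ≡ w × away u ≡ true) ⊎ (parentʷ w ≡ u × away w ≡ false)
    arcʷ⇒ u w t with parentʷ u ≟ʷ w | away u in p | parentʷ w ≟ʷ u | away w in q
    ... | yes e | true  | _     | _     = inj₁ (e , refl)
    ... | yes e | false | yes f | false = inj₂ (f , refl)
    ... | no _  | _     | yes f | false = inj₂ (f , refl)

    arcʷ-up : ∀ u → away u ≡ true → T (arcʷ u (parentʷ u))
    arcʷ-up u p rewrite dec-true (parentʷ u ≟ʷ parentʷ u) refl | p = _

    arcʷ-down : ∀ u → away u ≡ false → T (arcʷ (parentʷ u) u)
    arcʷ-down u p rewrite dec-true (parentʷ u ≟ʷ parentʷ u) refl | p = true⇒T (∨-true (does (parentʷ (parentʷ u) ≟ʷ u) ∧ away (parentʷ u)))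
      where
      ∨-true : ∀ b → b ∨ true ≡ true
      ∨-true true  = refl
      ∨-true false = refl

    arcʷ-asym : ∀ u w → T (arcʷ u w) → ¬ T (arcʷ w u)
    arcʷ-asym u w s t with arcʷ⇒ u w s | arcʷ⇒ w u t
    ... | inj₁ (refl , _) | inj₁ (p , _) = parent²≢ u p
    ... | inj₁ (_ , p)    | inj₂ (_ , q) = contradiction (trans (sym p) q) λ ()
    ... | inj₂ (_ , p)    | inj₁ (_ , q) = contradiction (trans (sym q) p) λ ()
    ... | inj₂ (refl , _) | inj₂ (p , _) = parent²≢ w p

    abstract
      order : ℕ
      order = suc N * 3

      dec : Fin order → W
      dec = remQuot 3

      enc : W → Fin order
      enc (i , l) = combine i l

      dec-enc : ∀ w → dec (enc w) ≡ w
      dec-enc (i , l) = remQuot-combine i l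

      enc-dec : ∀ x → enc (dec x) ≡ x
      enc-dec = combine-remQuot {suc N} 3

    enc-injective : ∀ {i j} → enc (i , zero) ≡ enc (j , zero) → i ≡ j
    enc-injective p = cong proj₁ (trans (sym (dec-enc _)) (trans (cong dec p) (dec-enc _)))

    G : OrientedGraph
    G = record { order = order ; arc = λ x y → arcʷ (dec x) (dec y) ; asym = λ {x} {y} → arcʷ-asym (dec x) (dec y) }

    open OrientedGraph G using (V; _⟶_; _~_)

    owned-away : ∀ w → away w ≡ true → enc w ⟶ enc (parentʷ w)
    owned-away w p = subst₂ (λ u v → T (arcʷ u v)) (sym (dec-enc w)) (sym (dec-enc (parentʷ w))) (arcʷ-up w p)

    owned-towards : ∀ w → away w ≡ false → enc (parentʷ w) ⟶ enc w
    owned-towards w p = subst₂ (λ u v → T (arcʷ u v)) (sym (dec-enc (parentʷ w))) (sym (dec-enc w)) (arcʷ-down w p)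

    Adjʷ : W → W → Set
    Adjʷ u w = parentʷ u ≡ w ⊎ parentʷ w ≡ u

    ~⇒ : ∀ {x y} → x ~ y → Adjʷ (dec x) (dec y)
    ~⇒ {x} {y} (fwd t) with arcʷ⇒ (dec x) (dec y) t
    ... | inj₁ (p , _) = inj₁ p
    ... | inj₂ (p , _) = inj₂ p
    ~⇒ {x} {y} (bwd t) with arcʷ⇒ (dec y) (dec x) t
    ... | inj₁ (p , _) = inj₂ p
    ... | inj₂ (p , _) = inj₁ p

    ~⇐ : ∀ {x y} → Adjʷ (dec x) (dec y) → x ~ y
    ~⇐ {x} {y} (inj₁ p) with away (dec x) in eq
    ... | true  = fwd (subst (T ∘ arcʷ (dec x)) p (arcʷ-up (dec x) eq))
    ... | false = bwd (subst (λ w → T (arcʷ w (dec x))) p (arcʷ-down (dec x) eq))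
    ~⇐ {x} {y} (inj₂ p) with away (dec y) in eq
    ... | true  = bwd (subst (T ∘ arcʷ (dec y)) p (arcʷ-up (dec y) eq))
    ... | false = fwd (subst (λ w → T (arcʷ w (dec y))) p (arcʷ-down (dec y) eq))

    parent : V → V
    parent x = enc (parentʷ (dec x))

    parent~ : ∀ x → x ~ parent x
    parent~ x = ~⇐ (inj₁ (sym (dec-enc (parentʷ (dec x)))))

    parent⇒ : ∀ {x y} → x ~ y → parent x ≡ y ⊎ parent y ≡ x
    parent⇒ {x} {y} a with ~⇒ a
    ... | inj₁ p = inj₁ (trans (cong enc p) (enc-dec y))
    ... | inj₂ p = inj₂ (trans (cong enc p) (enc-dec x))

    reaches-cycle : ∀ x i → Star (λ x y → parent x ≡ y) x (enc (i , zero))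
    reaches-cycle x i = subst (λ y → Star _ y _) (enc-dec x) (Star.gmap enc step (climb (dec x)))
      where
      step : ∀ {u w} → parentʷ u ≡ w → parent (enc u) ≡ enc w
      step {u} p = cong enc (trans (cong parentʷ (dec-enc u)) p)
      along : ∀ j → Star (λ u w → parentʷ u ≡ w) (j , zero) (i , zero)
      along j = Star.gmap (_, zero) (cong (_, zero)) (descend j i)
      climb : ∀ u → Star (λ u w → parentʷ u ≡ w) u (i , zero)
      climb (j , zero)           = along j
      climb (j , suc zero)       = refl ◅ along j
      climb (j , suc (suc zero)) = refl ◅ refl ◅ along j

    -- At a cycle vertex the order is predecessor, successor, pendant neighbour. All pendant paths
    -- therefore lie on one side of the cycle, and the cycle alone bounds the other.
    rotʷ : W → W → W
    rotʷ (i , zero) (j , zero) with j ≟ prev i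
    ... | yes _ = succ i , zero
    ... | no  _ = i , suc zero
    rotʷ (i , zero) (j , suc _)           = prev i , zero
    rotʷ (i , suc zero) (j , zero)        = i , suc (suc zero)
    rotʷ (i , suc zero) (j , suc _)       = i , zero
    rotʷ (i , suc (suc zero)) _           = i , suc zero

    rotʷ-prev : ∀ i → rotʷ (i , zero) (prev i , zero) ≡ (succ i , zero)
    rotʷ-prev i with prev i ≟ prev i
    ... | yes _ = refl
    ... | no ne = contradiction refl ne

    rotʷ-succ : ∀ i → rotʷ (i , zero) (succ i , zero) ≡ (i , suc zero)
    rotʷ-succ i with succ i ≟ prev i
    ... | yes p = contradiction p (succ≢prev 2≤N i)
    ... | no _  = refl

    data Neighbour : W → W → Set where
      back   : ∀ i → Neighbour (i , zero) (prev i , zero)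
      ahead  : ∀ i → Neighbour (i , zero) (succ i , zero)
      outer  : ∀ i → Neighbour (i , zero) (i , suc zero)
      inner  : ∀ i → Neighbour (i , suc zero) (i , zero)
      outer′ : ∀ i → Neighbour (i , suc zero) (i , suc (suc zero))
      inner′ : ∀ i → Neighbour (i , suc (suc zero)) (i , suc zero)

    neighbour : ∀ u w → Adjʷ u w → Neighbour u w
    neighbour (i , zero)           _                    (inj₁ refl) = back i
    neighbour (i , suc zero)       _                    (inj₁ refl) = inner i
    neighbour (i , suc (suc zero)) _                    (inj₁ refl) = inner′ i
    neighbour _                    (j , zero)           (inj₂ refl) = subst (λ k → Neighbour (prev j , zero) (k , zero)) (succ-prev j) (ahead (prev j))
    neighbour _                    (j , suc zero)       (inj₂ refl) = outer j
    neighbour _                    (j , suc (suc zero)) (inj₂ refl) = outer′ j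

    adjacent : ∀ {u w} → Neighbour u w → Adjʷ u w
    adjacent (back i)   = inj₁ refl
    adjacent (ahead i)  = inj₂ (cong (_, zero) (prev-succ i))
    adjacent (outer i)  = inj₂ refl
    adjacent (inner i)  = inj₁ refl
    adjacent (outer′ i) = inj₂ refl
    adjacent (inner′ i) = inj₁ refl

    rotʷ-closed : ∀ {u w} → Neighbour u w → Neighbour u (rotʷ u w)
    rotʷ-closed (back i)   = subst (Neighbour _) (sym (rotʷ-prev i)) (ahead i)
    rotʷ-closed (ahead i)  = subst (Neighbour _) (sym (rotʷ-succ i)) (outer i)
    rotʷ-closed (outer i)  = back i
    rotʷ-closed (inner i)  = outer′ i
    rotʷ-closed (outer′ i) = inner i
    rotʷ-closed (inner′ i) = inner′ i

    rotʷ-cyclic : ∀ {u w t} → Neighbour u w → Neighbour u t → Star (λ a b → rotʷ u a ≡ b) w t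
    rotʷ-cyclic (back i)   (back .i)   = ε
    rotʷ-cyclic (back i)   (ahead .i)  = rotʷ-prev i ◅ ε
    rotʷ-cyclic (back i)   (outer .i)  = rotʷ-prev i ◅ rotʷ-succ i ◅ ε
    rotʷ-cyclic (ahead i)  (back .i)   = rotʷ-succ i ◅ refl ◅ ε
    rotʷ-cyclic (ahead i)  (ahead .i)  = ε
    rotʷ-cyclic (ahead i)  (outer .i)  = rotʷ-succ i ◅ ε
    rotʷ-cyclic (outer i)  (back .i)   = refl ◅ ε
    rotʷ-cyclic (outer i)  (ahead .i)  = refl ◅ rotʷ-prev i ◅ ε
    rotʷ-cyclic (outer i)  (outer .i)  = ε
    rotʷ-cyclic (inner i)  (inner .i)  = ε
    rotʷ-cyclic (inner i)  (outer′ .i) = refl ◅ ε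
    rotʷ-cyclic (outer′ i) (inner .i)  = refl ◅ ε
    rotʷ-cyclic (outer′ i) (outer′ .i) = ε
    rotʷ-cyclic (inner′ i) (inner′ .i) = ε

    rotation : RotationSystem G
    rotation = record
      { rot    = rot
      ; closed = λ {x} {y} a → ~⇐ (subst (Adjʷ (dec x)) (sym (dec-enc _)) (adjacent (rotʷ-closed (neighbour _ _ (~⇒ a)))))
      ; cyclic = λ {x} {y} {z} a b → subst₂ (Star _) (enc-dec y) (enc-dec z)
          (Star.gmap enc (λ {u} p → cong enc (trans (cong (rotʷ (dec x)) (dec-enc u)) p)) (rotʷ-cyclic (neighbour _ _ (~⇒ a)) (neighbour _ _ (~⇒ b))))
      }
      where
      rot : V → V → V
      rot x y = enc (rotʷ (dec x) (dec y))

    open RotationSystem rotation using (reverse; next)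
    open Surface G rotation using (same-edge; genus)
    open Dart

    parent-dart : V → Dart G
    parent-dart x = dart x (parent x) (parent~ x)

    vertex-classes : Classes (_≡_ on tail {G}) order
    vertex-classes = tail , (λ x → parent-dart x , λ { refl → refl }) , λ _ _ → mk⇔ (λ p → p) (λ p → p)

    abstract
      edge-classes : ∃ (Classes (SameOrbit reverse))
      edge-classes = classes-orbits (finite-dart G) reverse

      face-classes : ∃ (Classes (SameOrbit next))
      face-classes = classes-orbits (finite-dart G) next

    component-classes : Classes (EqClosure _~_ on tail {G}) 1
    component-classes = (λ _ → zero) , (λ { zero → parent-dart (enc (zero , zero)) , λ _ → refl }) , λ d d′ →
      mk⇔ (λ _ → Eq.transitive _ (to-root (tail d)) (Eq.symmetric _ (to-root (tail d′)))) (λ _ → refl)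
      where
      to-root : ∀ x → EqClosure _~_ x (enc (zero , zero))
      to-root x = Star.map (λ { {x} refl → fwd (parent~ x) }) (reaches-cycle x zero)

    -- Every edge is the parent edge of one of its ends, so edges inject into vertices.
    edges≤order : proj₁ edge-classes ≤ order
    edges≤order = injective⇒≤ {f = owner ∘ rep E} (rep-injective E ∘ owner-injective _ _)
      where
      E = proj₂ edge-classes
      owner : Dart G → V
      owner (dart x y a) with parent⇒ a
      ... | inj₁ _ = x
      ... | inj₂ _ = y
      owned : ∀ d → SameOrbit reverse d (parent-dart (owner d))
      owned (dart x y a) with parent⇒ a
      ... | inj₁ refl = subst (SameOrbit reverse _) (dart-≡ G refl refl) (Eq.reflexive _)
      ... | inj₂ refl = Eq.return (dart-≡ G refl refl)
      owner-injective : ∀ d d′ → owner d ≡ owner d′ → SameOrbit reverse d d′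
      owner-injective d d′ p = Eq.transitive _ (owned d) (subst (λ x → SameOrbit reverse (parent-dart x) d′) (sym p) (Eq.symmetric _ (owned d′)))

    -- The boundary of the face without pendant paths: the cycle run through in ascending direction.
    Inside : Dart G → Set
    Inside (dart x y _) = ∃ λ i → dec x ≡ (i , zero) × dec y ≡ (succ i , zero)

    inside-next : ∀ {d} → Inside d → Inside (next d)
    inside-next {dart x y _} (i , p , q) = succ i , q , trans (dec-enc _) (trans (cong₂ rotʷ q (trans p (cong (_, zero) (sym (prev-succ i))))) (rotʷ-prev (succ i)))

    inside-prev : ∀ {d} → Inside (next d) → Inside d
    inside-prev {dart x y a} (i , p , q) = prev i , came (dec x) (trans (cong (λ u → rotʷ u (dec x)) (sym p)) (trans (sym (dec-enc _)) q)) , trans p (cong (_, zero) (sym (succ-prev i)))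
      where
      came : ∀ w → rotʷ (i , zero) w ≡ (succ i , zero) → w ≡ (prev i , zero)
      came (j , zero) e with j ≟ prev i
      ... | yes refl = refl
      came (j , zero) () | no _
      came (j , suc _) e = contradiction (sym (cong proj₁ e)) (succ≢prev 2≤N i)

    inside-orbit : ∀ {d d′} → SameOrbit next d d′ → (Inside d → Inside d′) × (Inside d′ → Inside d)
    inside-orbit = Eq.fold both-isEquivalence λ { {d} refl → inside-next {d} , inside-prev {d} }
      where
      Both : Dart G → Dart G → Set
      Both d d′ = (Inside d → Inside d′) × (Inside d′ → Inside d)
      both-isEquivalence : IsEquivalence Both
      both-isEquivalence = record
        { refl  = (λ p → p) , (λ p → p)
        ; sym   = λ (f , g) → g , f
        ; trans = λ (f , g) (f′ , g′) → f′ ∘ f , g ∘ g′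
        }

    -- Being `Inside` is invariant along faces, and it holds for just one of the two darts of a
    -- cycle edge.
    2≤faces : 2 ≤ proj₁ face-classes
    2≤faces = injective⇒≤ {f = f} f-injective
      where
      F = proj₂ face-classes
      d₂ : Dart G
      d₂ = parent-dart (enc (zero , zero))
      d₁ : Dart G
      d₁ = reverse d₂
      d₁-inside : Inside d₁
      d₁-inside = prev zero , trans (dec-enc _) (cong parentʷ (dec-enc (zero , zero))) , trans (dec-enc (zero , zero)) (cong (_, zero) (sym (succ-prev zero)))
      d₂-outside : ¬ Inside d₂
      d₂-outside (i , p , q) with trans (sym (dec-enc (zero , zero))) p
      ... | refl = succ≢prev 2≤N i (cong proj₁ (trans (sym q) (trans (dec-enc _) (cong parentʷ (dec-enc (zero , zero))))))
      f : Fin 2 → Fin (proj₁ face-classes)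
      f zero    = cls F d₁
      f (suc _) = cls F d₂
      apart : cls F d₁ ≢ cls F d₂
      apart p = d₂-outside (proj₁ (inside-orbit (cls⇒ F p)) d₁-inside)
      f-injective : ∀ {i j} → f i ≡ f j → i ≡ j
      f-injective {zero}     {zero}     _ = refl
      f-injective {zero}     {suc zero} p = contradiction p apart
      f-injective {suc zero} {zero}     p = contradiction (sym p) apart
      f-injective {suc zero} {suc zero} _ = refl

    -- Faces and edges are never counted exactly: `genus` gives one inequality, and e ≤ v with 2 ≤ f
    -- gives the other.
    planar : Planar G
    planar = rotation , record
      { v = order ; e = proj₁ edge-classes ; f = proj₁ face-classes ; c = 1
      ; vertices = vertex-classes ; edges = proj₂ edge-classes ; faces = proj₂ face-classes ; components = component-classes
      ; euler = ≤-antisym (genus vertex-classes (proj₂ edge-classes) (proj₂ face-classes) component-classes) (+-mono-≤ edges≤order 2≤faces)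
      }

    -- A cycle is closed under parents: once it runs against the parent
    -- relation it does so all the way round.
    girth : Girth≥ (suc N) G
    girth {m} C = injective⇒≤ {f = proj₁ ∘ hit} λ {i} {j} p → enc-injective
        (trans (sym (proj₂ (hit i))) (trans (cong vertex p) (proj₂ (hit j))))
      where
      open Cycle C
      2≤m : 2 ≤ m
      2≤m = ℕ.s≤s⁻¹ length≥3
      edge : ∀ j → vertex j ~ vertex (succ j)
      edge j with view j
      ... | ‵fromℕ     = closing
      ... | ‵inject₁ i = step i
      Against : Fin (suc m) → Set
      Against j = parent (vertex (succ j)) ≡ vertex j
      keep : ∀ j → Against j → Against (succ j)
      keep j p with parent⇒ (edge (succ j))
      ... | inj₁ q = contradiction (injective (trans (sym q) p)) (succ²≢ 2≤m j)
      ... | inj₂ q = q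
      keep^ : ∀ k j → Against j → Against (fold j succ k)
      keep^ zero    j p = p
      keep^ (suc k) j p = keep _ (keep^ k j p)
      closed : ∀ j → ∃ λ j′ → vertex j′ ≡ parent (vertex j)
      closed j with parent⇒ (edge j)
      ... | inj₁ p = succ j , sym p
      ... | inj₂ p with periodic (suc m , ↔-refl) succ (λ {x} {y} q → trans (sym (prev-succ x)) (trans (cong prev q) (prev-succ y))) j
        where open import Function.Properties.Inverse using (↔-refl)
      ...   | k , q = fold j succ k , trans (sym (keep^ k j p)) (cong (parent ∘ vertex) q)
      follow : ∀ {x y} → Star (λ x y → parent x ≡ y) x y → (∃ λ j → vertex j ≡ x) → ∃ λ j → vertex j ≡ y
      follow ε         h          = h
      follow (refl ◅ r) (j , refl) = follow r (closed j)
      hit : ∀ i → ∃ λ j → vertex j ≡ enc (i , zero)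
      hit i = follow (reaches-cycle (vertex zero) i) (zero , refl)

-- The lower and the upper bound for the family.

module Bounds where

  open import Defs renaming (_≤_ to _≤ᵘ_)
  open Extend
  open FoldNumbers
  open Intervals
  open Ratios
  open Zigzag
  open Sun
  open import Data.Bool.Base using (true; false; not)
  open import Data.Empty using (⊥)
  open import Data.Fin.Base using (Fin; zero; suc; toℕ)
  open import Data.Fin.Properties using (toℕ-injective; toℕ-inject₁; toℕ-fromℕ)
  open import Data.Integer.Base using (+_)
  open import Data.Nat.Base using (ℕ; zero; suc; _+_; _*_; _≤_; _<_; z≤n; s≤s; NonZero)
  open import Data.Nat.Properties
  open import Data.Product.Base using (∃; _,_; proj₁)
  open import Data.Rational.Base as ℚ using (ℚ; 0ℚ; _/_)
  import Data.Rational.Properties as ℚₚ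
  open import Relation.Binary.PropositionalEquality
  open import Relation.Nullary using (¬_; yes; no; contradiction)

  -- Indexes the cycle by natural numbers, as `Path` expects; faithful for indices up to `N`.
  clamp : ∀ N → ℕ → Fin (suc N)
  clamp N       zero    = zero
  clamp zero    (suc i) = zero
  clamp (suc N) (suc i) = suc (clamp N i)

  toℕ-clamp : ∀ {N i} → i ≤ N → toℕ (clamp N i) ≡ i
  toℕ-clamp {i = zero} z≤n = refl
  toℕ-clamp {i = suc i} (s≤s i≤N) = cong suc (toℕ-clamp i≤N)

  prev-clamp : ∀ {N i} → suc i ≤ N → prev (clamp N (suc i)) ≡ clamp N i
  prev-clamp {suc N} {i} (s≤s i≤N) = toℕ-injective (trans (toℕ-inject₁ (clamp N i)) (trans (toℕ-clamp i≤N) (sym (toℕ-clamp (m≤n⇒m≤1+n i≤N)))))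

  t≤up : ∀ t → t ≤ up t 0
  t≤up zero    = z≤n
  t≤up (suc t) = s≤s (m≤n⇒m≤1+n (t≤up t))

  module Witness (t : ℕ) where

    -- Evenness of `N` makes the cycle odd. Vertices 0 and `N` are then both even, and the edge
    -- owned by 0 is an arc from 0 to its predecessor `N`.
    N : ℕ
    N = up (suc t) 0

    2≤N : 2 ≤ N
    2≤N = s≤s (s≤s z≤n)

    open Sun.Graph N 2≤N

    not-few : ∀ {b k} .{{_ : NonZero b}} → FoldColoring G b k → ¬ (k < 4 * b)
    not-few C k<4b = zigzag-unclosed (suc t) refl closing
      where
      open Few C k<4b
      at : Fin 3 → ℕ → OrientedGraph.V G
      at l i = enc (clamp N i , l)
      arrow-parent : ∀ s w → even (toℕ (proj₁ w)) ≡ s → Arrow s (enc w) (enc (parentʷ w))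
      arrow-parent true  w p = owned-away w p
      arrow-parent false w p = owned-towards w p
      clamp-even : ∀ {i} → i ≤ N → even (toℕ (clamp N i)) ≡ even i
      clamp-even i≤N = cong even (toℕ-clamp i≤N)
      open Path N (at zero) (at (suc zero)) (at (suc (suc zero)))
        (λ i≤N → arrow-parent _ _ (clamp-even i≤N))
        (λ i≤N → arrow-parent _ _ (clamp-even i≤N))
        (λ {i} i<N → arrow-flip (even i) (subst (λ j → Arrow (not (even i)) (at zero (suc i)) (enc (j , zero))) (prev-clamp i<N)
          (arrow-parent _ _ (clamp-even i<N))))
      closing : OrientedGraph._⟶_ G (at zero 0) (at zero N)
      closing = subst (λ j → OrientedGraph._⟶_ G (at zero 0) (enc (j , zero))) (toℕ-injective (trans (toℕ-fromℕ N) (sym (toℕ-clamp ≤-refl))))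
        (owned-away (zero , zero) refl)

  -- The order of the rationals is decidable, so `4 < q` may be proved by contradiction: otherwise
  -- the witness of girth at least `g` would have a fold number with ratio below 4.
  lower-bound : ∀ g → fromℚ (+ 4 / 1) ≤ᵘ χ*ₒ-family (𝒫 g)
  lower-bound g {q} (p , p<q , above) with ℚₚ._<?_ (+ 4 / 1) q
  ... | yes 4<q = 4<q
  ... | no 4≮q  = contradiction (few (above (G , planar , λ C → ≤-trans g≤N (girth C)))) λ ()
    where
    open Witness g
    open Sun.Graph N 2≤N using (G; planar; girth)
    g≤N : g ≤ suc N
    g≤N = m≤n⇒m≤1+n (≤-trans (n≤1+n g) (t≤up (suc g)))
    few : (∃ λ (n : FoldNumber G) → FoldNumber.ratio n ℚ.< p) → ⊥
    few (n , ratio<p) = not-few (proj₁ minimal) (/<4⇒<4* k b (ℚₚ.<-trans ratio<p (ℚₚ.<-≤-trans p<q (ℚₚ.≮⇒≥ 4≮q))))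
      where open FoldNumber n

  upper-bound : ∀ ε → 0ℚ ℚ.< ε → ∃ λ g → χ*ₒ-family (𝒫 g) ≤ᵘ fromℚ (+ 4 / 1 ℚ.+ ε)
  upper-bound ε 0<ε with near4 ε 0<ε
  -- The rational below `q` that `sup` asks for is 4 + ε itself, since every graph of the family has
  -- a ratio strictly below it.
  ... | b-1 , near = g , λ {q} bound → _ , bound , below
    where
    M g : ℕ
    -- Then `suc M` is `4 * suc b-1`, the number of edges of a thread. Six times that number bounds
    -- both `6 * M` and, strictly, `suc M`.
    M = 3 + 4 * b-1
    g = 6 * suc M
    open Circular (suc b-1) M (sym (*-suc 4 b-1))
    below : ∀ G → ∃ λ (n : FoldNumber (proj₁ G)) → FoldNumber.ratio n ℚ.< + 4 / 1 ℚ.+ ε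
    below (G , planar , girth) with circular-coloring G {g} (s≤s z≤n) (*-monoʳ-≤ 6 (n≤1+n M)) (m<m+n (suc M) {5 * suc M} (s≤s z≤n)) planar girth
    ... | h , circular with foldNumber G (circular⇒fold (suc b-1) M (sym (*-suc 4 b-1)) G circular)
    ...   | m , m≤K , n , eq = n , subst (ℚ._< + 4 / 1 ℚ.+ ε) (sym eq) (near m (≤-trans m≤K (≤-reflexive (cong suc (sym (*-suc 4 b-1))))))

open Bounds using (lower-bound; upper-bound)

open import Defs
open import Data.Integer.Base using (+_)
open import Data.Nat.Base using (ℕ)
open import Data.Product.Base using (∃; _×_; _,_)
open import Data.Rational.Base using (ℚ; 0ℚ; _/_; _+_; _<_)

theorem6 : (ε : ℚ) → 0ℚ < ε → ∃ λ (g : ℕ) → fromℚ (+ 4 / 1) ≤ χ*ₒ-family (𝒫 g) × χ*ₒ-family (𝒫 g) ≤ fromℚ (+ 4 / 1 + ε)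
theorem6 ε 0<ε with upper-bound ε 0<ε
... | g , upper = g , lower-bound g , upper
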